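{- Let $\mathcal{P}$ be the set of integer partitions that satisfy Condition($2$), have all parts at least $2$, and in which the part $2$ appears at most once. Then, as formal power series in $x,q$, $$\sum_{\pi\in\mathcal{P}}x^{\ell(\pi)}q^{|\pi|}=\sum_{i,j,k\ge 0}\frac{x^{i+2j+3k}q^{\frac{(i+2j+3k)(i+2j+3k-1)}{2}+2i+j^2+4j+5k}}{(q;q)_i\,(q^2;q^2)_j\,(q^3;q^3)_k},$$ and also, writing $M=i+2j+3k+4l$, $$\sum_{\pi\in\mathcal{P}}x^{\ell(\pi)}q^{|\pi|}=\sum_{i,j,k,l\ge 0}(-1)^l\frac{x^{M}q^{\frac{M(M-1)}{2}+2i+5j+5k+2l^2+8l}}{(q;q)_i\,(q^2;q^2)_j\,(q^3;q^3)_k\,(q^4;q^4)_l}.$$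
   Context: Partitions are finite weakly increasing sequences of positive integers (the empty partition is included); $\ell(\pi)$ is the number of parts and $|\pi|$ the sum of the parts of $\pi$. For a fixed integer $c$, a partition $\pi=\lambda_1+\lambda_2+\cdots+\lambda_m$ with $\lambda_1\le\lambda_2\le\cdots\le\lambda_m$ satisfies Condition($c$) if $\lambda_{s+3}-\lambda_s\ge 3$ for all $1\le s\le m-3$, and, for all $1\le s\le m-2$, if $\lambda_{s+2}-\lambda_s\le 1$ then $\lambda_s+\lambda_{s+1}+\lambda_{s+2}\equiv c\pmod 3$. For $n\ge 0$, $(a;q)_n=\prod_{0\le t<n}(1-aq^t)$. All identities are identities of formal power series. -}

module Defs where

open import Data.Bool.Base using (if_then_else_)
open import Data.Integer.Base as ℤ using (ℤ; +_; 0ℤ; 1ℤ; -1ℤ)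
open import Data.Integer.Divisibility.Signed using (_∣_; _∣?_)
open import Data.List.Base using (List; []; _∷_; length; filter; tails; upTo; cartesianProductWith)
open import Data.List.Relation.Unary.All using (All; all?)
open import Data.List.Relation.Unary.Sorted.TotalOrder using (Sorted; sorted?)
open import Data.Nat.Base using (ℕ; zero; suc; _+_; _*_; _∸_; _^_; _≤_)
open import Data.Nat.DivMod using (_/_)
open import Data.Nat.ListAction using (sum)
open import Data.Nat.Properties using (_≟_; _≤?_; ≤-totalOrder)
open import Data.Product.Base using (_×_)
open import Data.Unit.Base using (⊤; tt)
open import Level using (0ℓ)
open import Relation.Binary.PropositionalEquality using (_≡_)
open import Relation.Nullary.Decidable using (yes; does; _×-dec_; _→-dec_)
open import Relation.Unary using (Pred; Decidable)

IsPartition : Pred (List ℕ) 0ℓ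
IsPartition π = Sorted ≤-totalOrder π × All (1 ≤_) π

isPartition? : Decidable IsPartition
isPartition? π = sorted? ≤-totalOrder _≤?_ π ×-dec all? (1 ≤?_) π

listsBelow : ℕ → ℕ → List (List ℕ)
listsBelow zero    b = [] ∷ []
listsBelow (suc m) b = cartesianProductWith _∷_ (upTo b) (listsBelow m b)

-- All partitions π with ℓ(π) = m and |π| = n, each listed once; a part of
-- such a π is at most n, so searching among the lists over {0,…,n} suffices.
partitions : ℕ → ℕ → List (List ℕ)
partitions m n =
  filter (λ π → isPartition? π ×-dec (sum π ≟ n)) (listsBelow m (suc n))

-- The clauses of Condition(c) for one index s, read off from the suffix
-- λₛ, λₛ₊₁, …, λₘ.  They are vacuous when λₛ₊₃ (resp. λₛ₊₂) does not exist.
-- Differences are moved across the inequalities to avoid truncated subtraction.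
Gap₃ : Pred (List ℕ) 0ℓ
Gap₃ (a ∷ _ ∷ _ ∷ d ∷ _) = a + 3 ≤ d
Gap₃ _                   = ⊤

Congruent₂ : ℤ → Pred (List ℕ) 0ℓ
Congruent₂ c (a ∷ b ∷ d ∷ _) = d ≤ a + 1 → + 3 ∣ (+ (a + b + d) ℤ.- c)
Congruent₂ c _               = ⊤

Condition : ℤ → Pred (List ℕ) 0ℓ
Condition c π = All Gap₃ (tails π) × All (Congruent₂ c) (tails π)

gap₃? : Decidable Gap₃
gap₃? []                      = yes tt
gap₃? (_ ∷ [])                = yes tt
gap₃? (_ ∷ _ ∷ [])            = yes tt
gap₃? (_ ∷ _ ∷ _ ∷ [])        = yes tt
gap₃? (a ∷ _ ∷ _ ∷ d ∷ _)     = a + 3 ≤? d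

congruent₂? : ∀ c → Decidable (Congruent₂ c)
congruent₂? c []              = yes tt
congruent₂? c (_ ∷ [])        = yes tt
congruent₂? c (_ ∷ _ ∷ [])    = yes tt
congruent₂? c (a ∷ b ∷ d ∷ _) =
  (d ≤? a + 1) →-dec (+ 3 ∣? (+ (a + b + d) ℤ.- c))

condition? : ∀ c → Decidable (Condition c)
condition? c π = all? gap₃? (tails π) ×-dec all? (congruent₂? c) (tails π)

-- Membership in 𝒫, for a list already known to be a partition.
In𝒫 : Pred (List ℕ) 0ℓ
In𝒫 π = Condition (+ 2) π × All (2 ≤_) π × length (filter (_≟ 2) π) ≤ 1

in𝒫? : Decidable In𝒫
in𝒫? π =
  condition? (+ 2) π ×-dec all? (2 ≤?_) π ×-dec (length (filter (_≟ 2) π) ≤? 1)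

QSeries : Set
QSeries = ℕ → ℤ

Σ≤ : ℕ → (ℕ → ℤ) → ℤ
Σ≤ zero    f = f 0
Σ≤ (suc n) f = Σ≤ n f ℤ.+ f (suc n)

q^_ : ℕ → QSeries
(q^ e) n = if does (n ≟ e) then 1ℤ else 0ℤ

𝟙 : QSeries
𝟙 = q^ 0

infixl 6 _⊖_
infixl 7 _⊗_ _⊘_
infixr 8 _↑_

_⊖_ : QSeries → QSeries → QSeries
(f ⊖ g) n = f n ℤ.- g n

_⊗_ : QSeries → QSeries → QSeries
(f ⊗ g) n = Σ≤ n λ k → f k ℤ.* g (n ∸ k)

_↑_ : QSeries → ℕ → QSeries
f ↑ zero  = 𝟙
f ↑ suc r = f ⊗ f ↑ r

-- The reciprocal of a series f with constant term 1, as the geometric series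
-- ∑ᵣ (1 − f)ʳ; the powers with r > n do not contribute to the coefficient of qⁿ.
-- Only meaningful when f 0 ≡ 1ℤ.
recip : QSeries → QSeries
recip f n = Σ≤ n λ r → ((𝟙 ⊖ f) ↑ r) n

_⊘_ : QSeries → QSeries → QSeries
f ⊘ g = f ⊗ recip g

-- ⟨ a ⨾ b ⟩ n is (a;b)ₙ = ∏_{0≤t<n} (1 − a bᵗ).
⟨_⨾_⟩_ : QSeries → QSeries → ℕ → QSeries
⟨ a ⨾ b ⟩ zero  = 𝟙
⟨ a ⨾ b ⟩ suc n = ⟨ a ⨾ b ⟩ n ⊗ (𝟙 ⊖ a ⊗ b ↑ n)

-- F m n is the coefficient of xᵐ qⁿ.
XQSeries : Set
XQSeries = ℕ → ℕ → ℤ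

infix 4 _≈_
_≈_ : XQSeries → XQSeries → Set
F ≈ G = ∀ m n → F m n ≡ G m n

infixr 7 _·_ x^_·_

_·_ : ℤ → XQSeries → XQSeries
(z · F) m n = z ℤ.* F m n

x^_·_ : ℕ → QSeries → XQSeries
(x^ e · f) m n = if does (m ≟ e) then f n else 0ℤ

-- The infinite sum ∑_{i≥0} F i of a family in which xⁱ divides F i, so that the
-- terms with i > m do not contribute to the coefficient of xᵐ.
-- Only meaningful for such families.
Σ∞ : (ℕ → XQSeries) → XQSeries
Σ∞ F m n = Σ≤ m λ i → F i m n

syntax Σ∞ (λ i → F) = Σ[ i ≥0] F
infix 5 Σ∞

-- ∑_π x^ℓ(π) q^|π| over the partitions π satisfying P: the coefficient of
-- xᵐ qⁿ is the number of such π with ℓ(π) = m and |π| = n.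
genFun : ∀ {P : Pred (List ℕ) 0ℓ} → Decidable P → XQSeries
genFun P? m n = + length (filter P? (partitions m n))

tripleSum : XQSeries
tripleSum =
  Σ[ i ≥0] Σ[ j ≥0] Σ[ k ≥0]
    let M = i + 2 * j + 3 * k in
    x^ M · ( (q^ (M * (M ∸ 1) / 2 + 2 * i + j ^ 2 + 4 * j + 5 * k))
           ⊘ ( ⟨ q^ 1 ⨾ q^ 1 ⟩ i
             ⊗ ⟨ q^ 2 ⨾ q^ 2 ⟩ j
             ⊗ ⟨ q^ 3 ⨾ q^ 3 ⟩ k))

quadrupleSum : XQSeries
quadrupleSum =
  Σ[ i ≥0] Σ[ j ≥0] Σ[ k ≥0] Σ[ l ≥0]
    let M = i + 2 * j + 3 * k + 4 * l in
    (-1ℤ ℤ.^ l) ·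
    x^ M · ( (q^ (M * (M ∸ 1) / 2 + 2 * i + 5 * j + 5 * k + 2 * l ^ 2 + 8 * l))
           ⊘ ( ⟨ q^ 1 ⨾ q^ 1 ⟩ i
             ⊗ ⟨ q^ 2 ⨾ q^ 2 ⟩ j
             ⊗ ⟨ q^ 3 ⨾ q^ 3 ⟩ k
             ⊗ ⟨ q^ 4 ⨾ q^ 4 ⟩ l))

{-# OPTIONS --safe #-}
module Submission where

-- Let Eₛ be the generating function of the partitions satisfying Condition(2) with all parts at
-- least s and s occurring at most once, and Dₛ the same with the start s, s+1, s+1 excluded.
-- Removing the smallest parts gives
--   Eₛ = Dₛ + x³ q^(3s+2) Eₛ₊₃,
--   Dₛ = x q^s Dₛ₊₁ + Eₛ₊₁ + x² q^(2s+2) Eₛ₊₃,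
-- and these recurrences determine E₂.  On the other side, dividing the coefficient of xᵐ in either
-- multisum by q^(m(m−1)/2) turns it, by Euler's identities, into
--   U(x) = (−x²q⁵;q²)_∞ / ((xq²;q)_∞ (x³q⁵;q³)_∞),
-- in the quadruple case through (x⁴q¹⁰;q⁴)_∞ / (x²q⁵;q²)_∞ = (−x²q⁵;q²)_∞.  Hence
--   (1 + x²q⁵) U(xq) = (1 − xq²)(1 − x³q⁵) U(x),
-- and restoring the factors q^(m(m−1)/2) turns this equation into the recurrences for Eₛ and Dₛ.

open import Algebra.Bundles using (CommutativeRing)
import Algebra.Construct.Pointwise as Pointwise
import Algebra.Properties.Semiring.Exp as Exponentiation
open import Algebra.Structures using (IsCommutativeRing)
open import Data.Bool.Base using (true; false; if_then_else_)
open import Data.Empty using (⊥)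
open import Data.Integer.Base as ℤ using (ℤ; +_; 0ℤ; 1ℤ; -1ℤ)
open import Data.Integer.Divisibility.Signed as ℤ using (divides; ∣m∣n⇒∣m+n; ∣⇒∣ᵤ; ∣-refl)
import Data.Integer.Properties as ℤ
open import Data.List.Base
  using (List; []; _∷_; _++_; length; filter; map; upTo; applyUpTo; cartesianProductWith)
open import Data.List.Properties using (filter-accept; filter-none; filter-reject)
open import Data.List.Relation.Unary.All as All using (All; []; _∷_)
open import Data.List.Relation.Unary.Linked as Linked using (Linked; []; [-]; _∷_)
open import Data.List.Relation.Unary.Linked.Properties using (Linked⇒All)
open import Data.Nat.Base as ℕ using (ℕ; zero; suc; _≤_; _<_; z≤n; s≤s)
import Data.Nat.Divisibility as ℕ
open import Data.Nat.DivMod using (_/_; m*n/n≡m)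
open import Data.Nat.ListAction using (sum)
import Data.Nat.Properties as ℕ
open import Data.Nat.Properties using (_≟_; _≤?_)
open import Data.Nat.Solver using (module +-*-Solver)
open import Data.Product.Base using (_×_; _,_; proj₁; proj₂; ∃)
open import Data.Sum.Base using (_⊎_; inj₁; inj₂)
open import Data.Unit.Base using (⊤; tt)
open import Function.Base using (_∘_; const; id)
open import Function.Bundles using (_⇔_; mk⇔)
open import Level using (0ℓ)
open import Relation.Binary.PropositionalEquality as ≡ using (_≡_; _≢_)
import Relation.Binary.Reasoning.Setoid as SetoidReasoning
open import Relation.Nullary.Decidable
  using (yes; no; does; _×-dec_; _→-dec_; ¬?; does-⇔; dec-false)
open import Relation.Nullary.Negation using (¬_; contradiction)
open import Relation.Unary using (Pred; Decidable; U; ∁; _∪_; _∩_)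
open import Relation.Unary.Properties using (U?; _∪?_; _∩?_)

-- Why one series U suffices: the weight q^(tm + m(m-1)/2) on the coefficient of xᵐ turns the
-- substitution x ↦ xq into t ↦ t + 1 and, up to a power of q, a factor xᵉ into t ↦ t + e. So U
-- yields a whole family indexed by t = s - 2, the candidate for Eₛ. Its Dₛ is defined by the first
-- recurrence, and the functional equation of U then becomes the second. Why D is carried along with
-- E: a triple of spread at most 1 must be a, a+1, a+1. Removing a lone s from a list counted by Eₛ
-- may therefore leave the start s+1, s+1 but never s+1, s+2, s+2, and neither family of type E
-- describes this. Setting the start s, s+1, s+1 aside repairs the mismatch. Why uniqueness is not
-- an induction on the degree: Eₛ₊₁ enters with coefficient 1, so the recurrences need not lower the
-- power of q. They are solved from large s, where only the empty partition reaches the given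
-- degree, downwards to s = 2. Power series are developed over an arbitrary commutative ring and
-- used twice, over ℤ for the variable q and over ℤ[[q]] for the variable x.

module FiniteSums (K : CommutativeRing 0ℓ 0ℓ) where
  open CommutativeRing K
  open SetoidReasoning setoid
  open import Algebra.Properties.CommutativeSemigroup +-commutativeSemigroup using (interchange)

  ∑ : ℕ → (ℕ → Carrier) → Carrier
  ∑ zero    f = f 0
  ∑ (suc n) f = ∑ n f + f (suc n)

  ∑-cong-≤ : ∀ n {f g} → (∀ {i} → i ≤ n → f i ≈ g i) → ∑ n f ≈ ∑ n g
  ∑-cong-≤ zero    f≈g = f≈g z≤n
  ∑-cong-≤ (suc n) f≈g =
    +-cong (∑-cong-≤ n (f≈g ∘ ℕ.m≤n⇒m≤1+n)) (f≈g ℕ.≤-refl)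

  ∑-cong : ∀ n {f g} → (∀ i → f i ≈ g i) → ∑ n f ≈ ∑ n g
  ∑-cong n f≈g = ∑-cong-≤ n λ {i} _ → f≈g i

  ∑-zero : ∀ n {f} → (∀ i → f i ≈ 0#) → ∑ n f ≈ 0#
  ∑-zero zero    f≈0 = f≈0 0
  ∑-zero (suc n) f≈0 = trans (+-cong (∑-zero n f≈0) (f≈0 (suc n))) (+-identityˡ 0#)

  ∑-+ : ∀ n f g → ∑ n (λ i → f i + g i) ≈ ∑ n f + ∑ n g
  ∑-+ zero    f g = refl
  ∑-+ (suc n) f g = trans (+-congʳ (∑-+ n f g)) (interchange _ _ _ _)

  ∑-head : ∀ n f → ∑ (suc n) f ≈ f 0 + ∑ n (f ∘ suc)
  ∑-head zero    f = refl
  ∑-head (suc n) f = trans (+-congʳ (∑-head n f)) (+-assoc _ _ _)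

  ∑-extend : ∀ {n N f} → n ≤ N → (∀ {i} → n < i → f i ≈ 0#) → ∑ N f ≈ ∑ n f
  ∑-extend {n} {f = f} n≤N f≈0 = go (ℕ.≤⇒≤′ n≤N)
    where
    go : ∀ {N} → n ℕ.≤′ N → ∑ N f ≈ ∑ n f
    go ℕ.≤′-refl        = refl
    go (ℕ.≤′-step n≤′N) =
      trans (+-cong (go n≤′N) (f≈0 (s≤s (ℕ.≤′⇒≤ n≤′N)))) (+-identityʳ _)

  *-distribˡ-∑ : ∀ n a f → a * ∑ n f ≈ ∑ n (λ i → a * f i)
  *-distribˡ-∑ zero    a f = refl
  *-distribˡ-∑ (suc n) a f = trans (distribˡ a _ _) (+-congʳ (*-distribˡ-∑ n a f))

  *-distribʳ-∑ : ∀ n a f → ∑ n f * a ≈ ∑ n (λ i → f i * a)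
  *-distribʳ-∑ zero    a f = refl
  *-distribʳ-∑ (suc n) a f = trans (distribʳ a _ _) (+-congʳ (*-distribʳ-∑ n a f))

-- Formal power series over a commutative ring

module FormalPowerSeries (K : CommutativeRing 0ℓ 0ℓ) where
  open CommutativeRing K
  open SetoidReasoning setoid
  open FiniteSums K
  open import Algebra.Properties.CommutativeSemigroup +-commutativeSemigroup using (interchange)

  Series : Set
  Series = ℕ → Carrier

  infix 4 _≋_
  _≋_ : Series → Series → Set
  f ≋ g = ∀ n → f n ≈ g n

  infixl 6 _⊕_
  _⊕_ : Series → Series → Series
  (f ⊕ g) n = f n + g n

  infixl 7 _⋆_ _∙_
  -- The Cauchy product by recursion on the degree, splitting off the constant term of the left
  -- factor; this makes the ring laws structural inductions. `⋆-as-∑` returns to the usual sum.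
  _⋆_ : Series → Series → Series
  (f ⋆ g) zero    = f 0 * g 0
  (f ⋆ g) (suc n) = f 0 * g (suc n) + ((f ∘ suc) ⋆ g) n

  _∙_ : Carrier → Series → Series
  (a ∙ f) n = a * f n

  constant : Carrier → Series
  constant a zero    = a
  constant a (suc n) = 0#

  -- Multiplication by the e-th power of the variable, recursive in order to avoid the truncated
  -- subtraction n ∸ e.
  delay : ℕ → Series → Series
  delay zero    f n       = f n
  delay (suc e) f zero    = 0#
  delay (suc e) f (suc n) = delay e f n

  monomial : ℕ → Carrier → Series
  monomial e a = delay e (constant a)

  ⋆-cong-≤ : ∀ n {f f′ g g′} → (∀ {i} → i ≤ n → f i ≈ f′ i) → (∀ {i} → i ≤ n → g i ≈ g′ i) →
             (f ⋆ g) n ≈ (f′ ⋆ g′) n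
  ⋆-cong-≤ zero    f≈ g≈ = *-cong (f≈ z≤n) (g≈ z≤n)
  ⋆-cong-≤ (suc n) f≈ g≈ =
    +-cong (*-cong (f≈ z≤n) (g≈ ℕ.≤-refl)) (⋆-cong-≤ n (f≈ ∘ s≤s) (g≈ ∘ ℕ.m≤n⇒m≤1+n))

  ⋆-cong : ∀ {f f′ g g′} → f ≋ f′ → g ≋ g′ → f ⋆ g ≋ f′ ⋆ g′
  ⋆-cong f≋ g≋ n = ⋆-cong-≤ n (λ {i} _ → f≋ i) (λ {i} _ → g≋ i)

  -- The mirror image of the defining recursion: the constant term is split off the right factor.
  -- Commutativity compares the two recursions.
  ⋆-suc : ∀ f g n → (f ⋆ g) (suc n) ≈ (f ⋆ (g ∘ suc)) n + f (suc n) * g 0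
  ⋆-suc f g zero    = refl
  ⋆-suc f g (suc n) = trans (+-congˡ (⋆-suc (f ∘ suc) g n)) (sym (+-assoc _ _ _))

  ⋆-comm : ∀ f g → f ⋆ g ≋ g ⋆ f
  ⋆-comm f g zero    = *-comm _ _
  ⋆-comm f g (suc n) = begin
    f 0 * g (suc n) + ((f ∘ suc) ⋆ g) n  ≈⟨ +-cong (*-comm _ _) (⋆-comm (f ∘ suc) g n) ⟩
    g (suc n) * f 0 + (g ⋆ (f ∘ suc)) n  ≈⟨ +-comm _ _ ⟩
    (g ⋆ (f ∘ suc)) n + g (suc n) * f 0  ≈⟨ ⋆-suc g f n ⟨
    (g ⋆ f) (suc n)                      ∎

  ⋆-distribʳ : ∀ h f g → (f ⊕ g) ⋆ h ≋ (f ⋆ h) ⊕ (g ⋆ h)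
  ⋆-distribʳ h f g zero    = distribʳ _ _ _
  ⋆-distribʳ h f g (suc n) =
    trans (+-cong (distribʳ _ _ _) (⋆-distribʳ h (f ∘ suc) (g ∘ suc) n)) (interchange _ _ _ _)

  ∙-⋆ : ∀ a f g → (a ∙ f) ⋆ g ≋ a ∙ (f ⋆ g)
  ∙-⋆ a f g zero    = *-assoc _ _ _
  ∙-⋆ a f g (suc n) = trans (+-cong (*-assoc _ _ _) (∙-⋆ a (f ∘ suc) g n)) (sym (distribˡ _ _ _))

  ⋆-assoc : ∀ f g h → (f ⋆ g) ⋆ h ≋ f ⋆ (g ⋆ h)
  ⋆-assoc f g h zero    = *-assoc _ _ _
  ⋆-assoc f g h (suc n) = begin
    f 0 * g 0 * h (suc n) + ((f 0 ∙ (g ∘ suc) ⊕ (f ∘ suc) ⋆ g) ⋆ h) n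
      ≈⟨ +-congˡ (⋆-distribʳ h (f 0 ∙ (g ∘ suc)) ((f ∘ suc) ⋆ g) n) ⟩
    f 0 * g 0 * h (suc n) + (((f 0 ∙ (g ∘ suc)) ⋆ h) n + (((f ∘ suc) ⋆ g) ⋆ h) n)
      ≈⟨ +-cong (*-assoc _ _ _) (+-cong (∙-⋆ (f 0) (g ∘ suc) h n) (⋆-assoc (f ∘ suc) g h n)) ⟩
    f 0 * (g 0 * h (suc n)) + (f 0 * ((g ∘ suc) ⋆ h) n + ((f ∘ suc) ⋆ (g ⋆ h)) n)
      ≈⟨ +-assoc _ _ _ ⟨
    f 0 * (g 0 * h (suc n)) + f 0 * ((g ∘ suc) ⋆ h) n + ((f ∘ suc) ⋆ (g ⋆ h)) n
      ≈⟨ +-congʳ (distribˡ _ _ _) ⟨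
    (f ⋆ (g ⋆ h)) (suc n) ∎

  zero-⋆ : ∀ f → const 0# ⋆ f ≋ const 0#
  zero-⋆ f zero    = zeroˡ _
  zero-⋆ f (suc n) = trans (+-cong (zeroˡ _) (zero-⋆ f n)) (+-identityˡ 0#)

  constant-⋆ : ∀ a f → constant a ⋆ f ≋ a ∙ f
  constant-⋆ a f zero    = refl
  constant-⋆ a f (suc n) = trans (+-congˡ (zero-⋆ f n)) (+-identityʳ _)

  ⋆-identityˡ : ∀ f → constant 1# ⋆ f ≋ f
  ⋆-identityˡ f n = trans (constant-⋆ 1# f n) (*-identityˡ _)

  ⋆-isCommutativeRing : IsCommutativeRing _≋_ _⊕_ _⋆_ (λ f n → - f n) (const 0#) (constant 1#)
  ⋆-isCommutativeRing = record
    { isRing = record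
      { +-isAbelianGroup = Pointwise.isAbelianGroup ℕ +-isAbelianGroup
      ; *-cong           = ⋆-cong
      ; *-assoc          = ⋆-assoc
      ; *-identity       =
          ⋆-identityˡ , λ f n → trans (⋆-comm f (constant 1#) n) (⋆-identityˡ f n)
      ; distrib          =
          (λ f g h n → trans (⋆-comm f (g ⊕ h) n)
             (trans (⋆-distribʳ f g h n) (+-cong (⋆-comm g f n) (⋆-comm h f n)))) ,
          ⋆-distribʳ
      }
    ; *-comm = ⋆-comm
    }

  seriesRing : CommutativeRing 0ℓ 0ℓ
  seriesRing = record { isCommutativeRing = ⋆-isCommutativeRing }

  constant-cong : ∀ {a b} → a ≈ b → constant a ≋ constant b
  constant-cong a≈b zero    = a≈b
  constant-cong a≈b (suc n) = refl

  constant-* : ∀ a b → a ∙ constant b ≋ constant (a * b)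
  constant-* a b zero    = refl
  constant-* a b (suc n) = zeroʳ a

  delay-cong : ∀ e {f g} → f ≋ g → delay e f ≋ delay e g
  delay-cong zero    f≋g n       = f≋g n
  delay-cong (suc e) f≋g zero    = refl
  delay-cong (suc e) f≋g (suc n) = delay-cong e f≋g n

  delay-delay : ∀ d e f n → delay d (delay e f) n ≡ delay (d ℕ.+ e) f n
  delay-delay zero    e f n       = ≡.refl
  delay-delay (suc d) e f zero    = ≡.refl
  delay-delay (suc d) e f (suc n) = delay-delay d e f n

  delay-⋆ : ∀ e f g → delay e f ⋆ g ≋ delay e (f ⋆ g)
  delay-⋆ zero    f g n       = refl
  delay-⋆ (suc e) f g zero    = zeroˡ _
  delay-⋆ (suc e) f g (suc n) = trans (+-cong (zeroˡ _) (delay-⋆ e f g n)) (+-identityˡ _)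

  delay-< : ∀ {e n} f → n < e → delay e f n ≡ 0#
  delay-< {suc e} {zero}  f _         = ≡.refl
  delay-< {suc e} {suc n} f (s≤s n<e) = delay-< f n<e

  -- A weight on the coefficients passes through xᵉ at the price of a shift of the weight. The
  -- weights qⁿ and q^(tn + n(n-1)/2) are the ones of interest.
  ∙-delay : ∀ (w : ℕ → Carrier) e f n →
            w n * delay e f n ≈ delay e (λ k → w (e ℕ.+ k) * f k) n
  ∙-delay w zero    f n       = refl
  ∙-delay w (suc e) f zero    = zeroʳ _
  ∙-delay w (suc e) f (suc n) = ∙-delay (w ∘ suc) e f n

  monomial-cong : ∀ e {a b} → a ≈ b → monomial e a ≋ monomial e b
  monomial-cong e a≈b = delay-cong e (constant-cong a≈b)

  monomial-⋆ : ∀ e a f → monomial e a ⋆ f ≋ delay e (a ∙ f)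
  monomial-⋆ e a f n =
    trans (delay-⋆ e (constant a) f n) (delay-cong e (constant-⋆ a f) n)

  ∙-monomial : ∀ (w : ℕ → Carrier) e a n → w n * monomial e a n ≈ monomial e (w e * a) n
  ∙-monomial w e a n = trans (∙-delay w e (constant a) n) (delay-cong e go n)
    where
    go : (λ k → w (e ℕ.+ k) * constant a k) ≋ constant (w e * a)
    go zero    = *-congʳ (reflexive (≡.cong w (ℕ.+-identityʳ e)))
    go (suc k) = zeroʳ _

  monomial-* : ∀ d e a b → monomial d a ⋆ monomial e b ≋ monomial (d ℕ.+ e) (a * b)
  monomial-* d e a b n = begin
    (monomial d a ⋆ monomial e b) n  ≈⟨ monomial-⋆ d a (monomial e b) n ⟩
    delay d (a ∙ monomial e b) n     ≈⟨ delay-cong d (∙-monomial (const a) e b) n ⟩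
    delay d (monomial e (a * b)) n   ≡⟨ delay-delay d e (constant (a * b)) n ⟩
    monomial (d ℕ.+ e) (a * b) n     ∎

  module ∑Series = FiniteSums seriesRing

  ∑-coefficient : ∀ N (F : ℕ → Series) n → ∑Series.∑ N F n ≡ ∑ N (λ i → F i n)
  ∑-coefficient zero    F n = ≡.refl
  ∑-coefficient (suc N) F n = ≡.cong (_+ F (suc N) n) (∑-coefficient N F n)

  ⋆-as-∑ : ∀ f g n → (f ⋆ g) n ≈ ∑ n (λ k → f k * g (n ℕ.∸ k))
  ⋆-as-∑ f g zero    = refl
  ⋆-as-∑ f g (suc n) =
    trans (+-congˡ (⋆-as-∑ (f ∘ suc) g n)) (sym (∑-head n λ k → f k * g (suc n ℕ.∸ k)))

  private module R = CommutativeRing seriesRing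
  open Exponentiation R.semiring using (_^_)
  open import Algebra.Properties.AbelianGroup +-abelianGroup using ()
    renaming (∙-cancelʳ to +-cancelʳ)

  geometric : Series → Series
  geometric h n = ∑ n λ r → (h ^ r) n

  ^-low : ∀ {h} → h 0 ≈ 0# → ∀ {r n} → n < r → (h ^ r) n ≈ 0#
  ^-low {h} h₀≈0 {suc r} {zero}  _         = trans (*-congʳ h₀≈0) (zeroˡ _)
  ^-low {h} h₀≈0 {suc r} {suc n} (s≤s n<r) = begin
    h 0 * (h ^ r) (suc n) + ((h ∘ suc) ⋆ (h ^ r)) n
      ≈⟨ +-cong (trans (*-congʳ h₀≈0) (zeroˡ _)) (⋆-cong-≤ n (λ _ → refl) λ i≤n → ^-low h₀≈0
           (ℕ.≤-<-trans i≤n n<r)) ⟩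
    0# + ((h ∘ suc) ⋆ const 0#) n
      ≈⟨ +-identityˡ _ ⟩
    ((h ∘ suc) ⋆ const 0#) n
      ≈⟨ R.zeroʳ (h ∘ suc) n ⟩
    0# ∎

  -- Powers of h above n vanish in degree n, so the truncated sum may be lengthened by one term; its
  -- head is 1 and the remaining terms share a factor h.
  geometric-fixed : ∀ {h} → h 0 ≈ 0# → geometric h ≋ constant 1# ⊕ h ⋆ geometric h
  geometric-fixed {h} h₀≈0 n = begin
    ∑ n (λ r → (h ^ r) n)
      ≈⟨ ∑-extend (ℕ.n≤1+n n) (^-low h₀≈0) ⟨
    ∑ (suc n) (λ r → (h ^ r) n)
      ≈⟨ ∑-head n (λ r → (h ^ r) n) ⟩
    constant 1# n + ∑ n (λ r → (h ⋆ h ^ r) n)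
      ≈⟨ +-congˡ (reflexive (∑-coefficient n (λ r → h ⋆ h ^ r) n)) ⟨
    constant 1# n + ∑Series.∑ n (λ r → h ⋆ h ^ r) n
      ≈⟨ +-congˡ (∑Series.*-distribˡ-∑ n h (h ^_) n) ⟨
    constant 1# n + (h ⋆ ∑Series.∑ n (h ^_)) n
      ≈⟨ +-congˡ (⋆-cong-≤ n (λ _ → refl) λ {i} i≤n →
           trans (reflexive (∑-coefficient n (h ^_) i)) (∑-extend i≤n (^-low h₀≈0))) ⟩
    constant 1# n + (h ⋆ geometric h) n ∎

  geometric-inverse : ∀ {f h} → f ⊕ h ≋ constant 1# → h 0 ≈ 0# → f ⋆ geometric h ≋ constant 1#
  geometric-inverse {f} {h} f+h≋1 h₀≈0 n = +-cancelʳ ((h ⋆ G) n) _ _ (begin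
    (f ⋆ G) n + (h ⋆ G) n         ≈⟨ ⋆-distribʳ G f h n ⟨
    ((f ⊕ h) ⋆ G) n               ≈⟨ ⋆-cong f+h≋1 (λ _ → refl) n ⟩
    (constant 1# ⋆ G) n           ≈⟨ ⋆-identityˡ G n ⟩
    G n                           ≈⟨ geometric-fixed h₀≈0 n ⟩
    constant 1# n + (h ⋆ G) n     ∎)
    where G = geometric h

-- Triangular exponents and q-difference equations

triangle : ℕ → ℕ
triangle zero    = 0
triangle (suc n) = n ℕ.+ triangle n

-- The cross term e k is what raises the parameter of `θ` by e when xᵉ is moved out of it.
triangle-+ : ∀ e k → triangle (e ℕ.+ k) ≡ triangle e ℕ.+ triangle k ℕ.+ e ℕ.* k
triangle-+ zero    k = ≡.sym (ℕ.+-identityʳ _)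
triangle-+ (suc e) k = ≡.trans (≡.cong (e ℕ.+ k ℕ.+_) (triangle-+ e k))
  (solve 4 (λ e k s t → e :+ k :+ (s :+ t :+ e :* k) := e :+ s :+ t :+ (k :+ e :* k))
    ≡.refl e k (triangle e) (triangle k))
  where open +-*-Solver

module QDifference (K : CommutativeRing 0ℓ 0ℓ) (q : CommutativeRing.Carrier K) where
  open CommutativeRing K
  open FiniteSums K
  open FormalPowerSeries K
  open Exponentiation semiring using (_^_; ^-homo-*; ^-congʳ)
  open import Algebra.Properties.CommutativeSemigroup *-commutativeSemigroup using (x∙yz≈y∙xz; interchange)
  private module X = CommutativeRing seriesRing
  open import Algebra.Properties.AbelianGroup X.+-abelianGroup using ()
    renaming (∙-cancelʳ to ⊕-cancelʳ)
  open import Algebra.Solver.Ring.NaturalCoefficients.Default X.commutativeSemiring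

  monomial-+ : ∀ e a b → monomial e (a + b) ≋ monomial e a ⊕ monomial e b
  monomial-+ zero    a b zero    = refl
  monomial-+ zero    a b (suc n) = sym (+-identityˡ 0#)
  monomial-+ (suc e) a b zero    = sym (+-identityˡ 0#)
  monomial-+ (suc e) a b (suc n) = monomial-+ e a b n

  -- The substitution x ↦ xq.
  σ : Series → Series
  σ f n = q ^ n * f n

  σ-⋆ : ∀ f g → σ (f ⋆ g) ≋ σ f ⋆ σ g
  σ-⋆ f g zero    = trans (*-identityˡ _) (sym (*-cong (*-identityˡ _) (*-identityˡ _)))
  σ-⋆ f g (suc n) = begin
    q ^ suc n * (f 0 * g (suc n) + ((f ∘ suc) ⋆ g) n)
      ≈⟨ distribˡ _ _ _ ⟩
    q ^ suc n * (f 0 * g (suc n)) + q * q ^ n * ((f ∘ suc) ⋆ g) n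
      ≈⟨ +-cong (trans (x∙yz≈y∙xz _ _ _) (*-congʳ (sym (*-identityˡ _))))
           (trans (*-assoc _ _ _) (*-congˡ (σ-⋆ (f ∘ suc) g n))) ⟩
    σ f 0 * σ g (suc n) + q * (σ (f ∘ suc) ⋆ σ g) n
      ≈⟨ +-congˡ (∙-⋆ q (σ (f ∘ suc)) (σ g) n) ⟨
    σ f 0 * σ g (suc n) + ((q ∙ σ (f ∘ suc)) ⋆ σ g) n
      ≈⟨ +-congˡ (⋆-cong (λ i → sym (*-assoc q (q ^ i) (f (suc i)))) (λ _ → refl) n) ⟩
    (σ f ⋆ σ g) (suc n) ∎
    where open SetoidReasoning setoid

  -- The series ∑ aᵢ xʳⁱ. For r ≥ 1 the terms with i > n do not reach xⁿ, so the truncation at n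
  -- loses nothing.
  sparse : ℕ → (ℕ → Carrier) → Series
  sparse r a n = ∑ n λ i → monomial (r ℕ.* i) (a i) n

  module _ (r : ℕ) .{{_ : ℕ.NonZero r}} where

    sparse-extend : ∀ {n N} a → n ≤ N → ∑ N (λ i → monomial (r ℕ.* i) (a i) n) ≈ sparse r a n
    sparse-extend a n≤N = ∑-extend n≤N λ {i} n<i →
      reflexive (delay-< (constant (a i)) (ℕ.<-≤-trans n<i (ℕ.m≤n*m i r)))

    ⋆-sparse : ∀ f a n → (f ⋆ sparse r a) n ≈ ∑ n λ i → (f ⋆ monomial (r ℕ.* i) (a i)) n
    ⋆-sparse f a n = begin
      (f ⋆ sparse r a) n
        ≈⟨ ⋆-cong-≤ n (λ _ → refl) (λ {i} i≤n → trans (reflexive (∑-coefficient n _ i))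
             (sparse-extend a i≤n)) ⟨
      (f ⋆ ∑Series.∑ n (λ i → monomial (r ℕ.* i) (a i))) n
        ≈⟨ ∑Series.*-distribˡ-∑ n f (λ i → monomial (r ℕ.* i) (a i)) n ⟩
      ∑Series.∑ n (λ i → f ⋆ monomial (r ℕ.* i) (a i)) n
        ≡⟨ ∑-coefficient n (λ i → f ⋆ monomial (r ℕ.* i) (a i)) n ⟩
      ∑ n (λ i → (f ⋆ monomial (r ℕ.* i) (a i)) n) ∎
      where open SetoidReasoning setoid

    -- Peels one sparse factor off a product and absorbs its general term into the leading monomial.
    -- Iterated, it expands a product into nested sums with the common bound n, the shape that `Σ∞`
    -- has.
    monomial-⋆-sparse-⋆ : ∀ e u a f n →
      (monomial e u ⋆ (sparse r a ⋆ f)) n ≈ ∑ n λ i → (monomial (e ℕ.+ r ℕ.* i) (u * a i) ⋆ f) n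
    monomial-⋆-sparse-⋆ e u a f n = begin
      (monomial e u ⋆ (sparse r a ⋆ f)) n
        ≈⟨ X.trans (X.sym (X.*-assoc (monomial e u) (sparse r a) f))
             (X.trans (X.*-congʳ (X.*-comm (monomial e u) (sparse r a)))
               (X.trans (X.*-assoc (sparse r a) (monomial e u) f)
                  (X.*-comm (sparse r a) (monomial e u ⋆ f)))) n ⟩
      (monomial e u ⋆ f ⋆ sparse r a) n
        ≈⟨ ⋆-sparse (monomial e u ⋆ f) a n ⟩
      ∑ n (λ i → (monomial e u ⋆ f ⋆ monomial (r ℕ.* i) (a i)) n)
        ≈⟨ ∑-cong n (λ i → X.trans (X.*-assoc (monomial e u) f (monomial (r ℕ.* i) (a i)))
             (X.trans (X.*-congˡ {monomial e u} (X.*-comm f (monomial (r ℕ.* i) (a i))))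
               (X.trans (X.sym (X.*-assoc (monomial e u) (monomial (r ℕ.* i) (a i)) f))
                 (X.*-congʳ {f} (monomial-* e (r ℕ.* i) u (a i))))) n) ⟩
      ∑ n (λ i → (monomial (e ℕ.+ r ℕ.* i) (u * a i) ⋆ f) n) ∎
      where open SetoidReasoning setoid

    σ-sparse : ∀ a → σ (sparse r a) ≋ sparse r (λ i → q ^ (r ℕ.* i) * a i)
    σ-sparse a n = trans (*-distribˡ-∑ n _ _) (∑-cong n λ i → ∙-monomial (q ^_) (r ℕ.* i) (a i) n)

    -- Under σ the term i = 0 is fixed and the term i + 1 gains q^(r(i+1)); by hypothesis the
    -- difference is y cᵢ, with a factor xʳ to spare. Taking c = a serves series of the type
    -- 1/(z)_∞, and cᵢ = q^(ri) aᵢ, which is σ again, those of the type (z)_∞.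
    sparse-q-difference : ∀ y {a c} →
      (∀ i → a (suc i) ≈ q ^ (r ℕ.* suc i) * a (suc i) + y * c i) →
      sparse r a ≋ σ (sparse r a) ⊕ monomial r y ⋆ sparse r c
    sparse-q-difference y {a} {c} a-suc n = begin
      sparse r a n
        ≈⟨ sparse-extend a (ℕ.n≤1+n n) ⟨
      ∑ (suc n) (term a)
        ≈⟨ ∑-head n (term a) ⟩
      term a 0 + ∑ n (term a ∘ suc)
        ≈⟨ +-cong (term-zero n) (trans (∑-cong n term-suc) (∑-+ n _ _)) ⟩
      term b 0 + (∑ n (term b ∘ suc) + ∑ n (λ i → (monomial r y ⋆ monomial (r ℕ.* i) (c i)) n))
        ≈⟨ +-assoc _ _ _ ⟨
      term b 0 + ∑ n (term b ∘ suc) + ∑ n (λ i → (monomial r y ⋆ monomial (r ℕ.* i) (c i)) n)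
        ≈⟨ +-cong (trans (sym (∑-head n (term b))) (sparse-extend b (ℕ.n≤1+n n)))
                  (sym (⋆-sparse (monomial r y) c n)) ⟩
      sparse r b n + (monomial r y ⋆ sparse r c) n
        ≈⟨ +-congʳ (σ-sparse a n) ⟨
      σ (sparse r a) n + (monomial r y ⋆ sparse r c) n ∎
      where
      open SetoidReasoning setoid

      b : ℕ → Carrier
      b i = q ^ (r ℕ.* i) * a i

      term : (ℕ → Carrier) → ℕ → Carrier
      term a i = monomial (r ℕ.* i) (a i) n

      term-zero : monomial (r ℕ.* 0) (a 0) ≋ monomial (r ℕ.* 0) (b 0)
      term-zero = monomial-cong (r ℕ.* 0)
        (sym (trans (*-congʳ (^-congʳ q (ℕ.*-zeroʳ r))) (*-identityˡ _)))

      term-suc : ∀ i → term a (suc i) ≈ term b (suc i) + (monomial r y ⋆ monomial (r ℕ.* i) (c i)) n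
      term-suc i = trans (monomial-cong (r ℕ.* suc i) (a-suc i) n)
        (trans (monomial-+ (r ℕ.* suc i) (b (suc i)) (y * c i) n)
          (+-congˡ (trans (reflexive (≡.cong (λ e → monomial e (y * c i) n) (ℕ.*-suc r i)))
                          (sym (monomial-* r (r ℕ.* i) y (c i) n)))))

  -- `θ 0` restores the factor q^(n(n-1)/2) that was divided out, and t adds the substitution x ↦
  -- xqᵗ.
  θ : ℕ → Series → Series
  θ t f n = q ^ (t ℕ.* n ℕ.+ triangle n) * f n

  θ-cong : ∀ t {f g} → f ≋ g → θ t f ≋ θ t g
  θ-cong t f≋g n = *-congˡ (f≋g n)

  θ-⊕ : ∀ t f g → θ t (f ⊕ g) ≋ θ t f ⊕ θ t g
  θ-⊕ t f g n = distribˡ _ _ _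

  θ-σ : ∀ t f → θ t (σ f) ≋ θ (suc t) f
  θ-σ t f n = trans (sym (*-assoc _ _ _)) (*-congʳ (trans (sym (^-homo-* q (t ℕ.* n ℕ.+ triangle n) n))
    (^-congʳ q (solve′ 3 (λ t n s → t :*′ n :+′ s :+′ n :=′ n :+′ t :*′ n :+′ s) ≡.refl t n (triangle n)))))
    where open +-*-Solver using () renaming (solve to solve′; _:*_ to _:*′_; _:+_ to _:+′_; _:=_ to _:=′_)

  θ-monomial-⋆ : ∀ t e y f →
    θ t (monomial e y ⋆ f) ≋ monomial e (q ^ (t ℕ.* e ℕ.+ triangle e) * y) ⋆ θ (e ℕ.+ t) f
  θ-monomial-⋆ t e y f n = begin
    w n * (monomial e y ⋆ f) n               ≈⟨ *-congˡ (monomial-⋆ e y f n) ⟩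
    w n * delay e (y ∙ f) n                  ≈⟨ ∙-delay w e (y ∙ f) n ⟩
    delay e (λ k → w (e ℕ.+ k) * (y * f k)) n ≈⟨ delay-cong e go n ⟩
    delay e ((w e * y) ∙ θ (e ℕ.+ t) f) n    ≈⟨ monomial-⋆ e (w e * y) (θ (e ℕ.+ t) f) n ⟨
    (monomial e (w e * y) ⋆ θ (e ℕ.+ t) f) n ∎
    where
    open SetoidReasoning setoid
    open +-*-Solver using () renaming (solve to solve′; _:*_ to _:*′_; _:+_ to _:+′_; _:=_ to _:=′_)

    w : ℕ → Carrier
    w n = q ^ (t ℕ.* n ℕ.+ triangle n)

    exponent : ∀ k → t ℕ.* (e ℕ.+ k) ℕ.+ triangle (e ℕ.+ k) ≡
               t ℕ.* e ℕ.+ triangle e ℕ.+ ((e ℕ.+ t) ℕ.* k ℕ.+ triangle k)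
    exponent k rewrite triangle-+ e k =
      solve′ 5 (λ t e k r s → t :*′ (e :+′ k) :+′ (r :+′ s :+′ e :*′ k) :=′
                              t :*′ e :+′ r :+′ ((e :+′ t) :*′ k :+′ s))
        ≡.refl t e k (triangle e) (triangle k)

    go : ∀ k → w (e ℕ.+ k) * (y * f k) ≈ w e * y * θ (e ℕ.+ t) f k
    go k = trans (*-congʳ (trans (^-congʳ q (exponent k)) (^-homo-* q (t ℕ.* e ℕ.+ triangle e) _)))
                 (interchange _ _ _ _)

  -- The functional equation of ∑ q^(−m(m−1)/2) Tₘ xᵐ, where ∑ Tₘ xᵐ is either side of the theorem.
  Functional : Series → Set
  Functional u = u ⊕ x ⋆ (z ⋆ u) ≋ σ u ⊕ y ⋆ σ u ⊕ x ⋆ u ⊕ z ⋆ u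
    where
    x = monomial 1 (q ^ 2)
    y = monomial 2 (q ^ 5)
    z = monomial 3 (q ^ 5)

  -- With signs, the hypotheses read (1 - x) a = σ a, b = (1 + y) σ b and (1 - z) c = σ c, where x,
  -- y, z are the monomials below; they multiply to (1 - x)(1 - z) abc = (1 + y) σ(abc). Negative
  -- terms are moved across so that every rearrangement is a semiring identity.
  product₃-functional : ∀ {a b c} →
    a ≋ σ a ⊕ monomial 1 (q ^ 2) ⋆ a →
    b ≋ σ b ⊕ monomial 2 (q ^ 5) ⋆ σ b →
    c ≋ σ c ⊕ monomial 3 (q ^ 5) ⋆ c →
    Functional (a ⋆ (b ⋆ c))
  product₃-functional {a} {b} {c} a-eq b-eq c-eq = begin
    a ⋆ (b ⋆ c) ⊕ x ⋆ (z ⋆ (a ⋆ (b ⋆ c)))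
      ≈⟨ solve 5 (λ a b c x z → a :* (b :* c) :+ x :* (z :* (a :* (b :* c))) :=
           b :* (a :* c :+ x :* z :* (a :* c))) X.refl a b c x z ⟩
    b ⋆ (a ⋆ c ⊕ x ⋆ z ⋆ (a ⋆ c))
      ≈⟨ X.*-congˡ {b} (X.+-congʳ {x ⋆ z ⋆ (a ⋆ c)} (X.*-congʳ {c} a-eq)) ⟩
    b ⋆ ((σ a ⊕ x ⋆ a) ⋆ c ⊕ x ⋆ z ⋆ (a ⋆ c))
      ≈⟨ solve 6 (λ a b c x z s → b :* ((s :+ x :* a) :* c :+ x :* z :* (a :* c)) :=
           b :* (s :* c :+ x :* a :* c :+ z :* (x :* a) :* c)) X.refl a b c x z (σ a) ⟩
    b ⋆ (σ a ⋆ c ⊕ x ⋆ a ⋆ c ⊕ z ⋆ (x ⋆ a) ⋆ c)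
      ≈⟨ X.*-congˡ {b} (X.+-congʳ {z ⋆ (x ⋆ a) ⋆ c} (X.+-congʳ {x ⋆ a ⋆ c} (X.*-congˡ {σ a} c-eq))) ⟩
    b ⋆ (σ a ⋆ (σ c ⊕ z ⋆ c) ⊕ x ⋆ a ⋆ c ⊕ z ⋆ (x ⋆ a) ⋆ c)
      ≈⟨ solve 7 (λ a b c x z s t → b :* (s :* (t :+ z :* c) :+ x :* a :* c :+ z :* (x :* a) :* c) :=
           b :* (s :* t) :+ x :* (a :* (b :* c)) :+ z :* ((s :+ x :* a) :* (b :* c))) X.refl a b c x z (σ a)
           (σ c) ⟩
    b ⋆ (σ a ⋆ σ c) ⊕ x ⋆ (a ⋆ (b ⋆ c)) ⊕ z ⋆ ((σ a ⊕ x ⋆ a) ⋆ (b ⋆ c))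
      ≈⟨ X.+-cong (X.+-congʳ {x ⋆ (a ⋆ (b ⋆ c))} (X.*-congʳ {σ a ⋆ σ c} b-eq))
           (X.*-congˡ {z} (X.*-congʳ {b ⋆ c} (X.sym a-eq))) ⟩
    (σ b ⊕ y ⋆ σ b) ⋆ (σ a ⋆ σ c) ⊕ x ⋆ (a ⋆ (b ⋆ c)) ⊕ z ⋆ (a ⋆ (b ⋆ c))
      ≈⟨ X.+-congʳ {z ⋆ (a ⋆ (b ⋆ c))} (X.+-congʳ {x ⋆ (a ⋆ (b ⋆ c))}
           (solve 4 (λ y r s t → (s :+ y :* s) :* (r :* t) := r :* (s :* t) :+ y :* (r :* (s :* t))) X.refl
           y (σ a) (σ b) (σ c))) ⟩
    σ a ⋆ (σ b ⋆ σ c) ⊕ y ⋆ (σ a ⋆ (σ b ⋆ σ c)) ⊕ x ⋆ (a ⋆ (b ⋆ c)) ⊕ z ⋆ (a ⋆ (b ⋆ c))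
      ≈⟨ X.+-congʳ {z ⋆ (a ⋆ (b ⋆ c))} (X.+-congʳ {x ⋆ (a ⋆ (b ⋆ c))}
           (X.+-cong σ-abc (X.*-congˡ {y} σ-abc))) ⟩
    σ (a ⋆ (b ⋆ c)) ⊕ y ⋆ σ (a ⋆ (b ⋆ c)) ⊕ x ⋆ (a ⋆ (b ⋆ c)) ⊕ z ⋆ (a ⋆ (b ⋆ c)) ∎
    where
    open SetoidReasoning X.setoid
    x = monomial 1 (q ^ 2)
    y = monomial 2 (q ^ 5)
    z = monomial 3 (q ^ 5)
    σ-abc : σ a ⋆ (σ b ⋆ σ c) ≋ σ (a ⋆ (b ⋆ c))
    σ-abc = X.sym (X.trans (σ-⋆ a (b ⋆ c)) (X.*-congˡ {σ a} (σ-⋆ b c)))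

  -- (1 − y) b = σ b and d = (1 − y²) σ d give b d = (1 + y) σ (b d).
  product₂-functional : ∀ y {b d} →
    b ≋ σ b ⊕ y ⋆ b →
    d ⊕ y ⋆ y ⋆ σ d ≋ σ d →
    b ⋆ d ≋ σ (b ⋆ d) ⊕ y ⋆ σ (b ⋆ d)
  product₂-functional y {b} {d} b-eq d-eq =
    ⊕-cancelʳ (y ⋆ y ⋆ (b ⋆ σ d)) (b ⋆ d) (σ (b ⋆ d) ⊕ y ⋆ σ (b ⋆ d)) (begin
    b ⋆ d ⊕ y ⋆ y ⋆ (b ⋆ σ d)
      ≈⟨ solve 4 (λ b d y t → b :* d :+ y :* y :* (b :* t) := b :* (d :+ y :* y :* t)) X.refl b d y (σ d) ⟩
    b ⋆ (d ⊕ y ⋆ y ⋆ σ d)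
      ≈⟨ X.*-cong b-eq d-eq ⟩
    (σ b ⊕ y ⋆ b) ⋆ σ d
      ≈⟨ X.*-congʳ {σ d} (X.+-congˡ {σ b} (X.*-congˡ {y} b-eq)) ⟩
    (σ b ⊕ y ⋆ (σ b ⊕ y ⋆ b)) ⋆ σ d
      ≈⟨ solve 4 (λ b y s t → (s :+ y :* (s :+ y :* b)) :* t :=
           s :* t :+ y :* (s :* t) :+ y :* y :* (b :* t)) X.refl b y (σ b) (σ d) ⟩
    σ b ⋆ σ d ⊕ y ⋆ (σ b ⋆ σ d) ⊕ y ⋆ y ⋆ (b ⋆ σ d)
      ≈⟨ X.+-congʳ {y ⋆ y ⋆ (b ⋆ σ d)} (X.+-cong (σ-⋆ b d) (X.*-congˡ {y} (σ-⋆ b d))) ⟨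
    σ (b ⋆ d) ⊕ y ⋆ σ (b ⋆ d) ⊕ y ⋆ y ⋆ (b ⋆ σ d) ∎)
    where open SetoidReasoning X.setoid

  xq : ℕ → ℕ → Series
  xq e s = monomial e (q ^ s)

  -- R e n stands for 1/(qᵉ;qᵉ)ₙ.
  record PochhammerReciprocals (R : ℕ → ℕ → Carrier) : Set where
    field
      R-zero : ∀ e → R e 0 ≈ 1#
      R-suc  : ∀ e .{{_ : ℕ.NonZero e}} n → R e (suc n) ≈ q ^ (e ℕ.* suc n) * R e (suc n) + R e n

  -- E t and D t are the series Eₛ and Dₛ with s = t + 2.
  record System (E D : ℕ → Series) : Set where
    field
      E-eq : ∀ t → E t ≋ D t ⊕ xq 3 (8 ℕ.+ 3 ℕ.* t) ⋆ E (3 ℕ.+ t)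
      D-eq : ∀ t → D t ≋ xq 1 (2 ℕ.+ t) ⋆ D (1 ℕ.+ t) ⊕ E (1 ℕ.+ t) ⊕ xq 2 (6 ℕ.+ 2 ℕ.* t) ⋆ E (3 ℕ.+ t)

  module _ {u} (functional : Functional u) where

    private
      -- `Δ` is chosen to make the first recurrence true by construction; the content of the
      -- functional equation goes into the second.
      Θ Δ : ℕ → Series
      Θ t = θ t u
      Δ t = Θ t X.- xq 3 (8 ℕ.+ 3 ℕ.* t) ⋆ Θ (3 ℕ.+ t)

      Θ-eq : ∀ t → Θ t ≋ Δ t ⊕ xq 3 (8 ℕ.+ 3 ℕ.* t) ⋆ Θ (3 ℕ.+ t)
      Θ-eq t = X.sym (X.trans (X.+-assoc (Θ t) (X.- w) w)
        (X.trans (X.+-congˡ {Θ t} (X.-‿inverseˡ w)) (X.+-identityʳ (Θ t))))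
        where w = xq 3 (8 ℕ.+ 3 ℕ.* t) ⋆ Θ (3 ℕ.+ t)

      shift : ∀ t e s {s′} f → t ℕ.* e ℕ.+ triangle e ℕ.+ s ≡ s′ →
              θ t (xq e s ⋆ f) ≋ xq e s′ ⋆ θ (e ℕ.+ t) f
      shift t e s f ≡.refl = X.trans (θ-monomial-⋆ t e (q ^ s) f)
        (X.*-congʳ {θ (e ℕ.+ t) f} (monomial-cong e (sym (^-homo-* q (t ℕ.* e ℕ.+ triangle e) s))))

      recurrence : ∀ t →
        Θ t ⊕ xq 1 (2 ℕ.+ t) ⋆ (xq 3 (8 ℕ.+ 3 ℕ.* suc t) ⋆ Θ (4 ℕ.+ t)) ≋
        Θ (1 ℕ.+ t) ⊕ xq 2 (6 ℕ.+ 2 ℕ.* t) ⋆ Θ (3 ℕ.+ t) ⊕ xq 1 (2 ℕ.+ t) ⋆ Θ (1 ℕ.+ t)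
          ⊕ xq 3 (8 ℕ.+ 3 ℕ.* t) ⋆ Θ (3 ℕ.+ t)
      recurrence t = begin
        Θ t ⊕ xq 1 (2 ℕ.+ t) ⋆ (xq 3 (8 ℕ.+ 3 ℕ.* suc t) ⋆ Θ (4 ℕ.+ t))
          ≈⟨ X.+-congˡ {Θ t} (X.trans (shift t 1 2 (xq 3 5 ⋆ u) (e₁ t))
               (X.*-congˡ {xq 1 (2 ℕ.+ t)} (shift (1 ℕ.+ t) 3 5 u (e₃ (1 ℕ.+ t))))) ⟨
        Θ t ⊕ θ t (xq 1 2 ⋆ (xq 3 5 ⋆ u))
          ≈⟨ θ-⊕ t u (xq 1 2 ⋆ (xq 3 5 ⋆ u)) ⟨
        θ t (u ⊕ xq 1 2 ⋆ (xq 3 5 ⋆ u))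
          ≈⟨ θ-cong t functional ⟩
        θ t (σ u ⊕ xq 2 5 ⋆ σ u ⊕ xq 1 2 ⋆ u ⊕ xq 3 5 ⋆ u)
          ≈⟨ X.trans (θ-⊕ t (σ u ⊕ xq 2 5 ⋆ σ u ⊕ xq 1 2 ⋆ u) (xq 3 5 ⋆ u))
               (X.+-congʳ {θ t (xq 3 5 ⋆ u)} (X.trans (θ-⊕ t (σ u ⊕ xq 2 5 ⋆ σ u) (xq 1 2 ⋆ u))
                 (X.+-congʳ {θ t (xq 1 2 ⋆ u)} (θ-⊕ t (σ u) (xq 2 5 ⋆ σ u))))) ⟩
        θ t (σ u) ⊕ θ t (xq 2 5 ⋆ σ u) ⊕ θ t (xq 1 2 ⋆ u) ⊕ θ t (xq 3 5 ⋆ u)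
          ≈⟨ X.+-cong (X.+-cong (X.+-cong (θ-σ t u)
               (X.trans (shift t 2 5 (σ u) (e₂ t)) (X.*-congˡ {xq 2 (6 ℕ.+ 2 ℕ.* t)} (θ-σ (2 ℕ.+ t) u))))
               (shift t 1 2 u (e₁ t))) (shift t 3 5 u (e₃ t)) ⟩
        Θ (1 ℕ.+ t) ⊕ xq 2 (6 ℕ.+ 2 ℕ.* t) ⋆ Θ (3 ℕ.+ t) ⊕ xq 1 (2 ℕ.+ t) ⋆ Θ (1 ℕ.+ t)
          ⊕ xq 3 (8 ℕ.+ 3 ℕ.* t) ⋆ Θ (3 ℕ.+ t) ∎
        where
        open SetoidReasoning X.setoid
        open +-*-Solver using () renaming (solve to solve′; _:*_ to _:*′_; _:+_ to _:+′_; _:=_ to _:=′_; con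
          to con′)
        e₁ : ∀ t → t ℕ.* 1 ℕ.+ 0 ℕ.+ 2 ≡ 2 ℕ.+ t
        e₁ = solve′ 1 (λ t → t :*′ con′ 1 :+′ con′ 0 :+′ con′ 2 :=′ con′ 2 :+′ t) ≡.refl
        e₂ : ∀ t → t ℕ.* 2 ℕ.+ 1 ℕ.+ 5 ≡ 6 ℕ.+ 2 ℕ.* t
        e₂ = solve′ 1 (λ t → t :*′ con′ 2 :+′ con′ 1 :+′ con′ 5 :=′ con′ 6 :+′ con′ 2 :*′ t) ≡.refl
        e₃ : ∀ t → t ℕ.* 3 ℕ.+ 3 ℕ.+ 5 ≡ 8 ℕ.+ 3 ℕ.* t
        e₃ = solve′ 1 (λ t → t :*′ con′ 3 :+′ con′ 3 :+′ con′ 5 :=′ con′ 8 :+′ con′ 3 :*′ t) ≡.refl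

      Δ-eq : ∀ t → Δ t ≋ xq 1 (2 ℕ.+ t) ⋆ Δ (1 ℕ.+ t) ⊕ Θ (1 ℕ.+ t) ⊕ xq 2 (6 ℕ.+ 2 ℕ.* t) ⋆ Θ (3 ℕ.+ t)
      -- `recurrence` speaks of `Θ` only. Adding Z completes `Δ t` to `Θ t`, and adding X₁ W
      -- completes `Δ (1 + t)` to `Θ (1 + t)` under the factor X₁.
      Δ-eq t = ⊕-cancelʳ (Z ⊕ X₁ ⋆ W) (Δ t) (X₁ ⋆ Δ (1 ℕ.+ t) ⊕ Θ (1 ℕ.+ t) ⊕ Y) (begin
        Δ t ⊕ (Z ⊕ X₁ ⋆ W)
          ≈⟨ X.+-assoc (Δ t) Z (X₁ ⋆ W) ⟨
        Δ t ⊕ Z ⊕ X₁ ⋆ W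
          ≈⟨ X.+-congʳ {X₁ ⋆ W} (Θ-eq t) ⟨
        Θ t ⊕ X₁ ⋆ W
          ≈⟨ recurrence t ⟩
        Θ (1 ℕ.+ t) ⊕ Y ⊕ X₁ ⋆ Θ (1 ℕ.+ t) ⊕ Z
          ≈⟨ X.+-congʳ {Z} (X.+-congˡ {Θ (1 ℕ.+ t) ⊕ Y} (X.*-congˡ {X₁} (Θ-eq (1 ℕ.+ t)))) ⟩
        Θ (1 ℕ.+ t) ⊕ Y ⊕ X₁ ⋆ (Δ (1 ℕ.+ t) ⊕ W) ⊕ Z
          ≈⟨ solve 6 (λ g y x d w z → g :+ y :+ x :* (d :+ w) :+ z := x :* d :+ g :+ y :+ (z :+ x :* w))
               X.refl (Θ (1 ℕ.+ t)) Y X₁ (Δ (1 ℕ.+ t)) W Z ⟩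
        X₁ ⋆ Δ (1 ℕ.+ t) ⊕ Θ (1 ℕ.+ t) ⊕ Y ⊕ (Z ⊕ X₁ ⋆ W) ∎)
        where
        open SetoidReasoning X.setoid
        X₁ = xq 1 (2 ℕ.+ t)
        Y = xq 2 (6 ℕ.+ 2 ℕ.* t) ⋆ Θ (3 ℕ.+ t)
        Z = xq 3 (8 ℕ.+ 3 ℕ.* t) ⋆ Θ (3 ℕ.+ t)
        W = xq 3 (8 ℕ.+ 3 ℕ.* suc t) ⋆ Θ (4 ℕ.+ t)

    θ-system : ∃ λ D → System (λ t → θ t u) D
    θ-system = Δ , record { E-eq = Θ-eq ; D-eq = Δ-eq }

-- The two multisums as products of q-series

module MultiSums
  (K : CommutativeRing 0ℓ 0ℓ) (q : CommutativeRing.Carrier K)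
  (R : ℕ → ℕ → CommutativeRing.Carrier K) (reciprocals : QDifference.PochhammerReciprocals K q R)
  where

  open CommutativeRing K
  open Exponentiation semiring using (_^_; ^-homo-*)
  open FiniteSums K
  open FormalPowerSeries K
  open QDifference K q
  open PochhammerReciprocals reciprocals
  open import Algebra.Properties.Ring ring using (-1*x≈-x)
  open import Algebra.Solver.Ring.NaturalCoefficients.Default commutativeSemiring
  private
    module X = CommutativeRing seriesRing
    module Exponents = +-*-Solver

  q^-+ : ∀ {m} k l → m ≡ k ℕ.+ l → q ^ m ≈ q ^ k * q ^ l
  q^-+ k l ≡.refl = ^-homo-* q k l

  -- Supplies the hypothesis of `sparse-q-difference` for terms sᵢ/(qʳ;qʳ)ᵢ: the recursion of the
  -- reciprocal produces the multiple by q^(r(i+1)), and h is the numerator that remains after y is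
  -- taken out of the next s.
  ratio : ∀ r .{{_ : ℕ.NonZero r}} y (s h c : ℕ → Carrier) →
    (∀ i → s (suc i) ≈ y * h i) → (∀ i → h i * R r i ≈ c i) →
    ∀ i → s (suc i) * R r (suc i) ≈ q ^ (r ℕ.* suc i) * (s (suc i) * R r (suc i)) + y * c i
  ratio r y s h c s-suc hR i = begin
    s (suc i) * R r (suc i)
      ≈⟨ *-congˡ (R-suc r i) ⟩
    s (suc i) * (q ^ (r ℕ.* suc i) * R r (suc i) + R r i)
      ≈⟨ solve 4 (λ s a b c → s :* (a :* b :+ c) := a :* (s :* b) :+ s :* c) refl _ _ _ _ ⟩
    q ^ (r ℕ.* suc i) * (s (suc i) * R r (suc i)) + s (suc i) * R r i
      ≈⟨ +-congˡ (trans (*-congʳ (s-suc i)) (trans (*-assoc _ _ _) (*-congˡ (hR i)))) ⟩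
    q ^ (r ℕ.* suc i) * (s (suc i) * R r (suc i)) + y * c i ∎
    where open SetoidReasoning setoid

  -- For ∑ q^(d i) xʳⁱ/(qʳ;qʳ)ᵢ, which is 1/(xʳqᵈ;qʳ)_∞.
  linear : ℕ → ℕ → ℕ → Carrier
  linear r d i = q ^ (d ℕ.* i) * R r i

  linear-functional : ∀ r .{{_ : ℕ.NonZero r}} d →
    sparse r (linear r d) ≋ σ (sparse r (linear r d)) ⊕ monomial r (q ^ d) ⋆ sparse r (linear r d)
  linear-functional r d = sparse-q-difference r (q ^ d)
    (ratio r (q ^ d) (λ i → q ^ (d ℕ.* i)) (λ i → q ^ (d ℕ.* i)) (linear r d)
      (λ i → q^-+ d (d ℕ.* i) (ℕ.*-suc d i)) (λ _ → refl))

  -- For ∑ q^(j²+4j) x²ʲ/(q²;q²)ⱼ, which is (−x²q⁵;q²)_∞.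
  squares : ℕ → Carrier
  squares j = q ^ (j ℕ.^ 2 ℕ.+ 4 ℕ.* j) * R 2 j

  squares-functional : sparse 2 squares ≋ σ (sparse 2 squares) ⊕ monomial 2 (q ^ 5) ⋆ σ (sparse 2 squares)
  squares-functional n = trans
    (sparse-q-difference 2 (q ^ 5) (ratio 2 (q ^ 5) (λ j → q ^ (j ℕ.^ 2 ℕ.+ 4 ℕ.* j))
      (λ j → q ^ (2 ℕ.* j) * q ^ (j ℕ.^ 2 ℕ.+ 4 ℕ.* j)) (λ j → q ^ (2 ℕ.* j) * squares j)
      (λ j → trans (q^-+ 5 (2 ℕ.* j ℕ.+ (j ℕ.^ 2 ℕ.+ 4 ℕ.* j)) (exponent j))
        (*-congˡ (^-homo-* q (2 ℕ.* j) _)))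
      (λ j → *-assoc _ _ _)) n)
    (+-congˡ (X.*-congˡ {monomial 2 (q ^ 5)} (X.sym (σ-sparse 2 squares)) n))
    where
    open Exponents using () renaming (solve to solve′; _:*_ to _:*′_; _:+_ to _:+′_; _:^_ to _:^′_; _:=_ to
      _:=′_; con to con′)
    exponent : ∀ j → suc j ℕ.^ 2 ℕ.+ 4 ℕ.* suc j ≡ 5 ℕ.+ (2 ℕ.* j ℕ.+ (j ℕ.^ 2 ℕ.+ 4 ℕ.* j))
    exponent = solve′ 1 (λ j → (con′ 1 :+′ j) :^′ 2 :+′ con′ 4 :*′ (con′ 1 :+′ j) :=′
                               con′ 5 :+′ (con′ 2 :*′ j :+′ (j :^′ 2 :+′ con′ 4 :*′ j))) ≡.refl

  -- For ∑ (−1)ˡ q^(2l²+8l) x⁴ˡ/(q⁴;q⁴)ₗ, which is (x⁴q¹⁰;q⁴)_∞.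
  signedSquares : ℕ → Carrier
  signedSquares l = (- 1#) ^ l * q ^ (2 ℕ.* l ℕ.^ 2 ℕ.+ 8 ℕ.* l) * R 4 l

  -- The leading factor of (x⁴q¹⁰;q⁴)_∞ is 1 - x⁴q¹⁰ = 1 - (x²q⁵)². It is written with a square, and
  -- without subtraction, to fit `product₂-functional`.
  signedSquares-functional :
    sparse 4 signedSquares ⊕ monomial 2 (q ^ 5) ⋆ monomial 2 (q ^ 5) ⋆ σ (sparse 4 signedSquares) ≋
    σ (sparse 4 signedSquares)
  signedSquares-functional n = begin
    D n + (monomial 2 (q ^ 5) ⋆ monomial 2 (q ^ 5) ⋆ σ D) n
      ≈⟨ +-congˡ (trans (X.*-congʳ {σ D} (X.trans (monomial-* 2 2 (q ^ 5) (q ^ 5))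
           (monomial-cong 4 (sym (^-homo-* q 5 5)))) n)
                        (monomial-⋆ 4 (q ^ 10) (σ D) n)) ⟩
    D n + delay 4 (q ^ 10 ∙ σ D) n
      ≈⟨ +-congʳ difference ⟩
    σ D n + - delay 4 (q ^ 10 ∙ σ D) n + delay 4 (q ^ 10 ∙ σ D) n
      ≈⟨ trans (+-assoc _ _ _) (trans (+-congˡ (-‿inverseˡ _)) (+-identityʳ _)) ⟩
    σ D n ∎
    where
    open SetoidReasoning setoid
    D = sparse 4 signedSquares

    sign : ℕ → Carrier
    sign l = (- 1#) ^ l

    open Exponents using () renaming (solve to solve′; _:*_ to _:*′_; _:+_ to _:+′_; _:^_ to _:^′_; _:=_ to
      _:=′_; con to con′)
    exponent : ∀ l → 2 ℕ.* suc l ℕ.^ 2 ℕ.+ 8 ℕ.* suc l ≡ 10 ℕ.+ (4 ℕ.* l ℕ.+ (2 ℕ.* l ℕ.^ 2 ℕ.+ 8 ℕ.* l))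
    exponent = solve′ 1 (λ l → con′ 2 :*′ (con′ 1 :+′ l) :^′ 2 :+′ con′ 8 :*′ (con′ 1 :+′ l) :=′
                               con′ 10 :+′ (con′ 4 :*′ l :+′ (con′ 2 :*′ l :^′ 2 :+′ con′ 8 :*′ l))) ≡.refl

    numerator : ∀ l → (- 1#) * sign l * q ^ (2 ℕ.* suc l ℕ.^ 2 ℕ.+ 8 ℕ.* suc l) ≈
                      (- 1# * q ^ 10) * (q ^ (4 ℕ.* l) * (sign l * q ^ (2 ℕ.* l ℕ.^ 2 ℕ.+ 8 ℕ.* l)))
    numerator l = trans
      (*-congˡ (trans (q^-+ 10 (4 ℕ.* l ℕ.+ (2 ℕ.* l ℕ.^ 2 ℕ.+ 8 ℕ.* l)) (exponent l))
        (*-congˡ (^-homo-* q (4 ℕ.* l) _))))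
      (solve 5 (λ e s a b c → e :* s :* (a :* (b :* c)) := (e :* a) :* (b :* (s :* c))) refl (- 1#) (sign l)
        (q ^ 10) (q ^ (4 ℕ.* l)) (q ^ (2 ℕ.* l ℕ.^ 2 ℕ.+ 8 ℕ.* l)))

    difference : D n ≈ σ D n + - delay 4 (q ^ 10 ∙ σ D) n
    difference = begin
      D n
        ≈⟨ sparse-q-difference 4 (- 1# * q ^ 10) (ratio 4 (- 1# * q ^ 10)
             (λ l → sign l * q ^ (2 ℕ.* l ℕ.^ 2 ℕ.+ 8 ℕ.* l))
             (λ l → q ^ (4 ℕ.* l) * (sign l * q ^ (2 ℕ.* l ℕ.^ 2 ℕ.+ 8 ℕ.* l)))
             (λ l → q ^ (4 ℕ.* l) * signedSquares l) numerator (λ l → *-assoc _ _ _)) n ⟩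
      σ D n + (monomial 4 (- 1# * q ^ 10) ⋆ sparse 4 (λ l → q ^ (4 ℕ.* l) * signedSquares l)) n
        ≈⟨ +-congˡ (X.*-congˡ {monomial 4 (- 1# * q ^ 10)} (σ-sparse 4 signedSquares) n) ⟨
      σ D n + (monomial 4 (- 1# * q ^ 10) ⋆ σ D) n
        ≈⟨ +-congˡ (trans (monomial-⋆ 4 (- 1# * q ^ 10) (σ D) n)
             (delay-cong 4 (λ k → *-assoc (- 1#) (q ^ 10) (σ D k)) n)) ⟩
      σ D n + delay 4 (- 1# ∙ (q ^ 10 ∙ σ D)) n
        ≈⟨ +-congˡ (∙-delay (const (- 1#)) 4 (q ^ 10 ∙ σ D) n) ⟨
      σ D n + - 1# * delay 4 (q ^ 10 ∙ σ D) n
        ≈⟨ +-congˡ (-1*x≈-x _) ⟩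
      σ D n + - delay 4 (q ^ 10 ∙ σ D) n ∎

  triple quadruple : Series
  triple    = sparse 1 (linear 1 2) ⋆ (sparse 2 squares ⋆ sparse 3 (linear 3 5))
  quadruple = sparse 1 (linear 1 2) ⋆
    (sparse 2 (linear 2 5) ⋆ sparse 4 signedSquares ⋆ sparse 3 (linear 3 5))

  triple-functional : Functional triple
  triple-functional =
    product₃-functional (linear-functional 1 2) squares-functional (linear-functional 3 5)

  quadruple-functional : Functional quadruple
  quadruple-functional = product₃-functional (linear-functional 1 2)
    (product₂-functional (monomial 2 (q ^ 5)) (linear-functional 2 5) signedSquares-functional)
    (linear-functional 3 5)

  1*R₀ : ∀ e → 1# * R e 0 ≈ 1#
  1*R₀ e = trans (*-identityˡ _) (R-zero e)

  triple-zero : triple 0 ≈ 1#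
  triple-zero = trans (*-cong (1*R₀ 1) (*-cong (1*R₀ 2) (1*R₀ 3)))
    (trans (*-identityˡ _) (*-identityˡ _))

  quadruple-zero : quadruple 0 ≈ 1#
  quadruple-zero = trans
    (*-cong (1*R₀ 1) (*-cong (*-cong (1*R₀ 2) (trans (*-congʳ (*-identityˡ _)) (1*R₀ 4))) (1*R₀ 3)))
    (trans (*-identityˡ _) (trans (*-identityʳ _) (*-identityˡ _)))

  monomial-cong₂ : ∀ {d e a b} n → d ≡ e → a ≈ b → monomial d a n ≈ monomial e b n
  monomial-cong₂ {d} n ≡.refl a≈b = monomial-cong d a≈b n

  θ-triple : ∀ m → θ 0 triple m ≈ ∑ m λ i → ∑ m λ j → ∑ m λ k →
    let M = i ℕ.+ 2 ℕ.* j ℕ.+ 3 ℕ.* k in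
    monomial M (q ^ (triangle M ℕ.+ 2 ℕ.* i ℕ.+ j ℕ.^ 2 ℕ.+ 4 ℕ.* j ℕ.+ 5 ℕ.* k)
                * (R 1 i * R 2 j * R 3 k)) m
  θ-triple m = begin
    w m * (A ⋆ (B ⋆ C)) m
      -- `monomial 0 1#` in front starts the accumulated monomial, and the final `X.1#` lets the
      -- last factor be peeled off like the others.
      ≈⟨ *-congˡ (X.trans (X.*-congˡ {A} (X.*-congˡ {B} (X.sym (X.*-identityʳ C))))
           (X.sym (X.*-identityˡ _)) m) ⟩
    w m * (monomial 0 1# ⋆ (A ⋆ (B ⋆ (C ⋆ X.1#)))) m
      ≈⟨ *-congˡ (monomial-⋆-sparse-⋆ 1 0 1# (linear 1 2) (B ⋆ (C ⋆ X.1#)) m) ⟩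
    w m * ∑ m (λ i → (monomial (1 ℕ.* i) (u₁ i) ⋆ (B ⋆ (C ⋆ X.1#))) m)
      ≈⟨ *-distribˡ-∑ m _ _ ⟩
    ∑ m (λ i → w m * (monomial (1 ℕ.* i) (u₁ i) ⋆ (B ⋆ (C ⋆ X.1#))) m)
      ≈⟨ ∑-cong m (λ i → trans (*-congˡ (monomial-⋆-sparse-⋆ 2 (1 ℕ.* i) (u₁ i) squares (C ⋆ X.1#) m))
           (*-distribˡ-∑ m _ _)) ⟩
    ∑ m (λ i → ∑ m λ j → w m * (monomial (1 ℕ.* i ℕ.+ 2 ℕ.* j) (u₂ i j) ⋆ (C ⋆ X.1#)) m)
      ≈⟨ ∑-cong m (λ i → ∑-cong m λ j → trans
           (*-congˡ (monomial-⋆-sparse-⋆ 3 (1 ℕ.* i ℕ.+ 2 ℕ.* j) (u₂ i j) (linear 3 5) X.1# m))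
             (*-distribˡ-∑ m _ _)) ⟩
    ∑ m (λ i → ∑ m λ j → ∑ m λ k → w m * (monomial (1 ℕ.* i ℕ.+ 2 ℕ.* j ℕ.+ 3 ℕ.* k) (u₃ i j k) ⋆ X.1#) m)
      ≈⟨ ∑-cong m (λ i → ∑-cong m λ j → ∑-cong m λ k → term i j k) ⟩
    _ ∎
    where
    open SetoidReasoning setoid
    A = sparse 1 (linear 1 2)
    B = sparse 2 squares
    C = sparse 3 (linear 3 5)

    w : ℕ → Carrier
    w n = q ^ triangle n

    u₁ : ℕ → Carrier
    u₁ i = 1# * linear 1 2 i
    u₂ : ℕ → ℕ → Carrier
    u₂ i j = u₁ i * squares j
    u₃ : ℕ → ℕ → ℕ → Carrier
    u₃ i j k = u₂ i j * linear 3 5 k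

    term : ∀ i j k → let M = i ℕ.+ 2 ℕ.* j ℕ.+ 3 ℕ.* k in
      w m * (monomial (1 ℕ.* i ℕ.+ 2 ℕ.* j ℕ.+ 3 ℕ.* k) (u₃ i j k) ⋆ X.1#) m ≈
      monomial M (q ^ (triangle M ℕ.+ 2 ℕ.* i ℕ.+ j ℕ.^ 2 ℕ.+ 4 ℕ.* j ℕ.+ 5 ℕ.* k) *
        (R 1 i * R 2 j * R 3 k)) m
    term i j k = begin
      w m * (monomial M′ (u₃ i j k) ⋆ X.1#) m
        ≈⟨ *-congˡ (trans (X.*-identityʳ (monomial M′ (u₃ i j k)) m) (monomial-cong₂ m M′≡M refl)) ⟩
      w m * monomial M (u₃ i j k) m
        ≈⟨ ∙-monomial w M (u₃ i j k) m ⟩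
      monomial M (w M * u₃ i j k) m
        ≈⟨ monomial-cong M (solve 7 (λ t a r b s c p →
             t :* (con 1 :* (a :* r) :* (b :* s) :* (c :* p)) := t :* a :* b :* c :* (r :* s :* p)) refl
             (w M) (q ^ (2 ℕ.* i)) (R 1 i) (q ^ (j ℕ.^ 2 ℕ.+ 4 ℕ.* j)) (R 2 j) (q ^ (5 ℕ.* k)) (R 3 k)) m ⟩
      monomial M (w M * q ^ (2 ℕ.* i) * q ^ (j ℕ.^ 2 ℕ.+ 4 ℕ.* j) * q ^ (5 ℕ.* k) * (R 1 i * R 2 j * R 3 k))
        m
        ≈⟨ monomial-cong M (*-congʳ (trans (q^-+ (triangle M ℕ.+ 2 ℕ.* i ℕ.+ j ℕ.^ 2 ℕ.+ 4 ℕ.* j) (5 ℕ.* k)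
             ≡.refl)
             (*-congʳ (trans (q^-+ (triangle M ℕ.+ 2 ℕ.* i) (j ℕ.^ 2 ℕ.+ 4 ℕ.* j)
               (ℕ.+-assoc (triangle M ℕ.+ 2 ℕ.* i) (j ℕ.^ 2) (4 ℕ.* j)))
               (*-congʳ (^-homo-* q (triangle M) (2 ℕ.* i))))))) m ⟨
      monomial M (q ^ (triangle M ℕ.+ 2 ℕ.* i ℕ.+ j ℕ.^ 2 ℕ.+ 4 ℕ.* j ℕ.+ 5 ℕ.* k) *
        (R 1 i * R 2 j * R 3 k)) m ∎
      where
      M = i ℕ.+ 2 ℕ.* j ℕ.+ 3 ℕ.* k
      M′ = 1 ℕ.* i ℕ.+ 2 ℕ.* j ℕ.+ 3 ℕ.* k
      M′≡M : M′ ≡ M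
      M′≡M = ≡.cong (λ i → i ℕ.+ 2 ℕ.* j ℕ.+ 3 ℕ.* k) (ℕ.*-identityˡ i)

  θ-quadruple : ∀ m → θ 0 quadruple m ≈ ∑ m λ i → ∑ m λ j → ∑ m λ k → ∑ m λ l →
    let M = i ℕ.+ 2 ℕ.* j ℕ.+ 3 ℕ.* k ℕ.+ 4 ℕ.* l in
    monomial M ((- 1#) ^ l * (q ^ (triangle M ℕ.+ 2 ℕ.* i ℕ.+ 5 ℕ.* j ℕ.+ 5 ℕ.* k ℕ.+ 2 ℕ.* l ℕ.^ 2 ℕ.+
      8 ℕ.* l)
                * (R 1 i * R 2 j * R 3 k * R 4 l))) m
  θ-quadruple m = begin
    w m * (A ⋆ (B ⋆ D ⋆ C)) m
      -- B and D stand together for `product₂-functional`; the summation order i, j, k, l needs C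
      -- before D.
      ≈⟨ *-congˡ (X.trans (X.*-congˡ {A} (X.trans (X.*-assoc B D C)
           (X.*-congˡ {B} (X.trans (X.*-comm D C) (X.*-congˡ {C} (X.sym (X.*-identityʳ D)))))))
                          (X.sym (X.*-identityˡ _)) m) ⟩
    w m * (monomial 0 1# ⋆ (A ⋆ (B ⋆ (C ⋆ (D ⋆ X.1#))))) m
      ≈⟨ *-congˡ (monomial-⋆-sparse-⋆ 1 0 1# (linear 1 2) (B ⋆ (C ⋆ (D ⋆ X.1#))) m) ⟩
    w m * ∑ m (λ i → (monomial (1 ℕ.* i) (u₁ i) ⋆ (B ⋆ (C ⋆ (D ⋆ X.1#)))) m)
      ≈⟨ *-distribˡ-∑ m _ _ ⟩
    ∑ m (λ i → w m * (monomial (1 ℕ.* i) (u₁ i) ⋆ (B ⋆ (C ⋆ (D ⋆ X.1#)))) m)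
      ≈⟨ ∑-cong m (λ i → trans (*-congˡ (monomial-⋆-sparse-⋆ 2 (1 ℕ.* i) (u₁ i) (linear 2 5)
           (C ⋆ (D ⋆ X.1#)) m)) (*-distribˡ-∑ m _ _)) ⟩
    ∑ m (λ i → ∑ m λ j → w m * (monomial (1 ℕ.* i ℕ.+ 2 ℕ.* j) (u₂ i j) ⋆ (C ⋆ (D ⋆ X.1#))) m)
      ≈⟨ ∑-cong m (λ i → ∑-cong m λ j → trans
           (*-congˡ (monomial-⋆-sparse-⋆ 3 (1 ℕ.* i ℕ.+ 2 ℕ.* j) (u₂ i j) (linear 3 5) (D ⋆ X.1#) m))
             (*-distribˡ-∑ m _ _)) ⟩
    ∑ m (λ i → ∑ m λ j → ∑ m λ k → w m * (monomial (1 ℕ.* i ℕ.+ 2 ℕ.* j ℕ.+ 3 ℕ.* k) (u₃ i j k) ⋆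
      (D ⋆ X.1#)) m)
      ≈⟨ ∑-cong m (λ i → ∑-cong m λ j → ∑-cong m λ k → trans
           (*-congˡ (monomial-⋆-sparse-⋆ 4 (1 ℕ.* i ℕ.+ 2 ℕ.* j ℕ.+ 3 ℕ.* k)
             (u₃ i j k) signedSquares X.1# m)) (*-distribˡ-∑ m _ _)) ⟩
    ∑ m (λ i → ∑ m λ j → ∑ m λ k → ∑ m λ l → w m *
      (monomial (1 ℕ.* i ℕ.+ 2 ℕ.* j ℕ.+ 3 ℕ.* k ℕ.+ 4 ℕ.* l) (u₄ i j k l) ⋆ X.1#) m)
      ≈⟨ ∑-cong m (λ i → ∑-cong m λ j → ∑-cong m λ k → ∑-cong m λ l → term i j k l) ⟩
    _ ∎
    where
    open SetoidReasoning setoid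
    A = sparse 1 (linear 1 2)
    B = sparse 2 (linear 2 5)
    C = sparse 3 (linear 3 5)
    D = sparse 4 signedSquares

    w : ℕ → Carrier
    w n = q ^ triangle n

    u₁ : ℕ → Carrier
    u₁ i = 1# * linear 1 2 i
    u₂ : ℕ → ℕ → Carrier
    u₂ i j = u₁ i * linear 2 5 j
    u₃ : ℕ → ℕ → ℕ → Carrier
    u₃ i j k = u₂ i j * linear 3 5 k
    u₄ : ℕ → ℕ → ℕ → ℕ → Carrier
    u₄ i j k l = u₃ i j k * signedSquares l

    term : ∀ i j k l → let M = i ℕ.+ 2 ℕ.* j ℕ.+ 3 ℕ.* k ℕ.+ 4 ℕ.* l in
      w m * (monomial (1 ℕ.* i ℕ.+ 2 ℕ.* j ℕ.+ 3 ℕ.* k ℕ.+ 4 ℕ.* l) (u₄ i j k l) ⋆ X.1#) m ≈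
      monomial M ((- 1#) ^ l * (q ^ (triangle M ℕ.+ 2 ℕ.* i ℕ.+ 5 ℕ.* j ℕ.+ 5 ℕ.* k ℕ.+ 2 ℕ.* l ℕ.^ 2 ℕ.+
        8 ℕ.* l)
                  * (R 1 i * R 2 j * R 3 k * R 4 l))) m
    term i j k l = begin
      w m * (monomial M′ (u₄ i j k l) ⋆ X.1#) m
        ≈⟨ *-congˡ (trans (X.*-identityʳ (monomial M′ (u₄ i j k l)) m) (monomial-cong₂ m M′≡M refl)) ⟩
      w m * monomial M (u₄ i j k l) m
        ≈⟨ ∙-monomial w M (u₄ i j k l) m ⟩
      monomial M (w M * u₄ i j k l) m
        ≈⟨ monomial-cong M (solve 10 (λ t a r b s c p e d v →
             t :* (con 1 :* (a :* r) :* (b :* s) :* (c :* p) :* (e :* d :* v)) :=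
               e :* (t :* a :* b :* c :* d :* (r :* s :* p :* v))) refl
             (w M) (q ^ (2 ℕ.* i)) (R 1 i) (q ^ (5 ℕ.* j)) (R 2 j) (q ^ (5 ℕ.* k)) (R 3 k)
             ((- 1#) ^ l) (q ^ (2 ℕ.* l ℕ.^ 2 ℕ.+ 8 ℕ.* l)) (R 4 l)) m ⟩
      monomial M ((- 1#) ^ l * (w M * q ^ (2 ℕ.* i) * q ^ (5 ℕ.* j) * q ^ (5 ℕ.* k) * q ^
        (2 ℕ.* l ℕ.^ 2 ℕ.+ 8 ℕ.* l)
                  * (R 1 i * R 2 j * R 3 k * R 4 l))) m
        ≈⟨ monomial-cong M (*-congˡ (*-congʳ (
             trans (q^-+ e₃ (2 ℕ.* l ℕ.^ 2 ℕ.+ 8 ℕ.* l) (ℕ.+-assoc e₃ (2 ℕ.* l ℕ.^ 2) (8 ℕ.* l)))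
               (*-congʳ (trans (^-homo-* q e₂ (5 ℕ.* k))
                 (*-congʳ (trans (^-homo-* q e₁ (5 ℕ.* j))
                   (*-congʳ (^-homo-* q (triangle M) (2 ℕ.* i)))))))))) m ⟨
      monomial M ((- 1#) ^ l * (q ^ (e₃ ℕ.+ 2 ℕ.* l ℕ.^ 2 ℕ.+ 8 ℕ.* l) * (R 1 i * R 2 j * R 3 k * R 4 l)))
        m ∎
      where
      M = i ℕ.+ 2 ℕ.* j ℕ.+ 3 ℕ.* k ℕ.+ 4 ℕ.* l
      M′ = 1 ℕ.* i ℕ.+ 2 ℕ.* j ℕ.+ 3 ℕ.* k ℕ.+ 4 ℕ.* l
      M′≡M : M′ ≡ M
      M′≡M = ≡.cong (λ i → i ℕ.+ 2 ℕ.* j ℕ.+ 3 ℕ.* k ℕ.+ 4 ℕ.* l) (ℕ.*-identityˡ i)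
      e₁ = triangle M ℕ.+ 2 ℕ.* i
      e₂ = e₁ ℕ.+ 5 ℕ.* j
      e₃ = e₂ ℕ.+ 5 ℕ.* k

-- The ring ℤ[[q]] and the series of the statement

open import Defs

module ∑ℤ = FiniteSums ℤ.+-*-commutativeRing
module ℤ[[q]] = FormalPowerSeries ℤ.+-*-commutativeRing
module 𝕂 = CommutativeRing ℤ[[q]].seriesRing
module ∑𝕂 = FiniteSums ℤ[[q]].seriesRing
open ℤ[[q]] using (_≋_; _⋆_; monomial; delay)
open Exponentiation 𝕂.semiring using (_^_; ^-assocʳ; ^-homo-*)

q : QSeries
q = monomial 1 1ℤ

module ℤ[[q,x]] = FormalPowerSeries ℤ[[q]].seriesRing
private module X = CommutativeRing ℤ[[q,x]].seriesRing
open ℤ[[q,x]] using () renaming (_⋆_ to _⊛_; _⊕_ to _⊞_)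
open QDifference ℤ[[q]].seriesRing q

^-monomial : ∀ a → q ^ a ≋ monomial a 1ℤ
^-monomial zero    = 𝕂.refl
^-monomial (suc a) = 𝕂.trans (𝕂.*-congˡ {q} (^-monomial a)) (ℤ[[q]].monomial-* 1 a 1ℤ 1ℤ)

^-⋆ : ∀ a f → (q ^ a) ⋆ f ≋ delay a f
^-⋆ a f n = ≡.trans (𝕂.*-congʳ {f} (^-monomial a) n)
  (≡.trans (ℤ[[q]].monomial-⋆ a 1ℤ f n) (ℤ[[q]].delay-cong a (λ k → ℤ.*-identityˡ (f k)) n))

q^-monomial : ∀ e → q^ e ≋ monomial e 1ℤ
q^-monomial zero    zero    = ≡.refl
q^-monomial zero    (suc n) = ≡.refl
q^-monomial (suc e) zero    = ≡.refl
q^-monomial (suc e) (suc n) = q^-monomial e n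

q^≋^ : ∀ e → q^ e ≋ q ^ e
q^≋^ e = 𝕂.trans (q^-monomial e) (𝕂.sym (^-monomial e))

𝟙≋1# : 𝟙 ≋ 𝕂.1#
𝟙≋1# = q^-monomial 0

Σ≤-∑ : ∀ n {f g} → (∀ i → f i ≡ g i) → Σ≤ n f ≡ ∑ℤ.∑ n g
Σ≤-∑ zero    f≡g = f≡g 0
Σ≤-∑ (suc n) f≡g = ≡.cong₂ ℤ._+_ (Σ≤-∑ n f≡g) (f≡g (suc n))

⊗≋⋆ : ∀ {f f′ g g′} → f ≋ f′ → g ≋ g′ → f ⊗ g ≋ f′ ⋆ g′
⊗≋⋆ {f} {g = g} f≋ g≋ n = ≡.trans (Σ≤-∑ n (λ _ → ≡.refl))
  (≡.trans (≡.sym (ℤ[[q]].⋆-as-∑ f g n)) (𝕂.*-cong f≋ g≋ n))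

⊖≋- : ∀ {f f′ g g′} → f ≋ f′ → g ≋ g′ → f ⊖ g ≋ f′ 𝕂.- g′
⊖≋- f≋ g≋ n = ≡.cong₂ ℤ._-_ (f≋ n) (g≋ n)

↑≋^ : ∀ {f g} → f ≋ g → ∀ r → f ↑ r ≋ g ^ r
↑≋^ f≋g zero    = 𝟙≋1#
↑≋^ f≋g (suc r) = ⊗≋⋆ f≋g (↑≋^ f≋g r)

1≋- : ∀ {f h} → f 𝕂.+ h ≋ 𝕂.1# → 𝟙 ⊖ f ≋ h
1≋- {f} {h} f+h≋1 = begin
  𝟙 ⊖ f                    ≈⟨ ⊖≋- 𝟙≋1# (𝕂.refl {f}) ⟩
  𝕂.1# 𝕂.- f               ≈⟨ 𝕂.+-congʳ {𝕂.- f} (𝕂.sym f+h≋1) ⟩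
  f 𝕂.+ h 𝕂.- f            ≈⟨ xyx⁻¹≈y f h ⟩
  h                        ∎
  where
  open SetoidReasoning 𝕂.setoid
  open import Algebra.Properties.AbelianGroup 𝕂.+-abelianGroup using (xyx⁻¹≈y)

recip-geometric : ∀ {f h} → f 𝕂.+ h ≋ 𝕂.1# → recip f ≋ ℤ[[q]].geometric h
recip-geometric f+h≋1 n = Σ≤-∑ n λ r → ↑≋^ (1≋- f+h≋1) r n

recip-fixed : ∀ {f h} → f 𝕂.+ h ≋ 𝕂.1# → h 0 ≡ 0ℤ → recip f ≋ 𝕂.1# 𝕂.+ h ⋆ recip f
recip-fixed {f} {h} f+h≋1 h₀≡0 = 𝕂.trans recip≋ (𝕂.trans (ℤ[[q]].geometric-fixed h₀≡0)
  (𝕂.+-congˡ {𝕂.1#} (𝕂.*-congˡ {h} (𝕂.sym recip≋))))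
  where recip≋ = recip-geometric {f} {h} f+h≋1

recip-inverse : ∀ f → f 0 ≡ 1ℤ → f ⋆ recip f ≋ 𝕂.1#
recip-inverse f f₀≡1 = 𝕂.trans (𝕂.*-congˡ {f} (recip-geometric {f} f+h≋1))
  (ℤ[[q]].geometric-inverse f+h≋1 (≡.cong (λ z → 1ℤ ℤ.- z) f₀≡1))
  where
  f+h≋1 : f 𝕂.+ (𝕂.1# 𝕂.- f) ≋ 𝕂.1#
  f+h≋1 = 𝕂.trans (𝕂.sym (𝕂.+-assoc f 𝕂.1# (𝕂.- f))) (xyx⁻¹≈y f 𝕂.1#)
    where open import Algebra.Properties.AbelianGroup 𝕂.+-abelianGroup using (xyx⁻¹≈y)

-- Uniqueness of inverses: 1 is inserted as (f · 1/f)(g · 1/g), and fg is cancelled against its own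
-- reciprocal.
recip-⊗ : ∀ f g → f 0 ≡ 1ℤ → g 0 ≡ 1ℤ → recip (f ⊗ g) ≋ recip f ⋆ recip g
recip-⊗ f g f₀ g₀ = begin
  recip (f ⊗ g)
    ≈⟨ 𝕂.*-identityˡ (recip (f ⊗ g)) ⟨
  𝕂.1# ⋆ recip (f ⊗ g)
    ≈⟨ 𝕂.*-congʳ {recip (f ⊗ g)} (𝕂.trans (𝕂.*-cong (recip-inverse f f₀) (recip-inverse g g₀))
         (𝕂.*-identityˡ 𝕂.1#)) ⟨
  (f ⋆ recip f) ⋆ (g ⋆ recip g) ⋆ recip (f ⊗ g)
    ≈⟨ solve 5 (λ f g u v w → f :* u :* (g :* v) :* w := f :* g :* w :* (u :* v)) 𝕂.refl f g (recip f)
         (recip g) (recip (f ⊗ g)) ⟩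
  (f ⋆ g) ⋆ recip (f ⊗ g) ⋆ (recip f ⋆ recip g)
    ≈⟨ 𝕂.*-congʳ {recip f ⋆ recip g} (𝕂.trans (𝕂.*-congʳ {recip (f ⊗ g)}
         (𝕂.sym (⊗≋⋆ {f} {f} {g} {g} 𝕂.refl 𝕂.refl))) (recip-inverse (f ⊗ g) (≡.cong₂ ℤ._*_ f₀ g₀))) ⟩
  𝕂.1# ⋆ (recip f ⋆ recip g)
    ≈⟨ 𝕂.*-identityˡ (recip f ⋆ recip g) ⟩
  recip f ⋆ recip g ∎
  where
  open SetoidReasoning 𝕂.setoid
  open import Algebra.Solver.Ring.NaturalCoefficients.Default 𝕂.commutativeSemiring

pochhammer : ℕ → ℕ → QSeries
pochhammer e n = ⟨ q^ e ⨾ q^ e ⟩ n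

pochhammer₀ : ∀ e .{{_ : ℕ.NonZero e}} n → pochhammer e n 0 ≡ 1ℤ
pochhammer₀ e       zero    = ≡.refl
pochhammer₀ (suc e) (suc n) = ≡.cong₂ ℤ._*_ (pochhammer₀ (suc e) n) ≡.refl

R : ℕ → ℕ → QSeries
R e n = recip (pochhammer e n)

R-zero : ∀ e → R e 0 ≋ 𝕂.1#
R-zero e = 𝕂.trans (recip-fixed {𝟙} {𝕂.0#} (𝕂.trans (𝕂.+-identityʳ 𝟙) 𝟙≋1#) ≡.refl)
  (𝕂.trans (𝕂.+-congˡ {𝕂.1#} (𝕂.zeroˡ (R e 0))) (𝕂.+-identityʳ 𝕂.1#))

-- With h = q^(e(n+1)) this is 1/(1 - h) = 1 + h/(1 - h), multiplied by 1/(qᵉ;qᵉ)ₙ. Matching e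
-- against a successor lets the constant terms of h and 1 - h compute to 0 and 1.
R-suc : ∀ e .{{_ : ℕ.NonZero e}} n → R e (suc n) ≋ q ^ (e ℕ.* suc n) ⋆ R e (suc n) 𝕂.+ R e n
R-suc e@(suc _) n = begin
  R e (suc n)                     ≈⟨ R-suc≋ ⟩
  R e n ⋆ v                       ≈⟨ 𝕂.*-congˡ {R e n} (recip-fixed {𝟙 ⊖ Q} f+h≋1 ≡.refl) ⟩
  R e n ⋆ (𝕂.1# 𝕂.+ h ⋆ v)        ≈⟨ solve 3 (λ r h v → r :* (con 1 :+ h :* v) := h :* (r :* v) :+ r) 𝕂.refl
    (R e n) h v ⟩
  h ⋆ (R e n ⋆ v) 𝕂.+ R e n       ≈⟨ 𝕂.+-congʳ {R e n} (𝕂.*-congˡ {h} R-suc≋) ⟨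
  h ⋆ R e (suc n) 𝕂.+ R e n       ∎
  where
  open SetoidReasoning 𝕂.setoid
  open import Algebra.Solver.Ring.NaturalCoefficients.Default 𝕂.commutativeSemiring
  Q h v : QSeries
  Q = q^ e ⊗ (q^ e) ↑ n
  h = q ^ (e ℕ.* suc n)
  v = recip (𝟙 ⊖ Q)

  R-suc≋ : R e (suc n) ≋ R e n ⋆ v
  R-suc≋ = recip-⊗ (pochhammer e n) (𝟙 ⊖ Q) (pochhammer₀ e n) ≡.refl

  f+h≋1 : (𝟙 ⊖ Q) 𝕂.+ h ≋ 𝕂.1#
  f+h≋1 = begin
    (𝟙 ⊖ Q) 𝕂.+ h            ≈⟨ 𝕂.+-cong (⊖≋- 𝟙≋1# (𝕂.trans (↑≋^ (q^≋^ e) (suc n)) (^-assocʳ q e (suc n))))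
      (𝕂.refl {h}) ⟩
    𝕂.1# 𝕂.- h 𝕂.+ h         ≈⟨ 𝕂.+-assoc 𝕂.1# (𝕂.- h) h ⟩
    𝕂.1# 𝕂.+ (𝕂.- h 𝕂.+ h)   ≈⟨ 𝕂.+-congˡ {𝕂.1#} (𝕂.-‿inverseˡ h) ⟩
    𝕂.1# 𝕂.+ 𝕂.0#            ≈⟨ 𝕂.+-identityʳ 𝕂.1# ⟩
    𝕂.1#                     ∎

R-reciprocals : PochhammerReciprocals R
R-reciprocals = record { R-zero = R-zero ; R-suc = R-suc }

open MultiSums ℤ[[q]].seriesRing q R R-reciprocals

triangle-half : ∀ m → m ℕ.* (m ℕ.∸ 1) / 2 ≡ triangle m
triangle-half m = ≡.trans (≡.cong (_/ 2) (twice m)) (m*n/n≡m (triangle m) 2)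
  where
  open +-*-Solver
  twice : ∀ m → m ℕ.* (m ℕ.∸ 1) ≡ triangle m ℕ.* 2
  twice zero          = ≡.refl
  twice (suc zero)    = ≡.refl
  twice (suc (suc m)) = ≡.trans
    (solve 1 (λ m → (con 2 :+ m) :* (con 1 :+ m) := (con 1 :+ m) :* m :+ (con 1 :+ m) :* con 2) ≡.refl m)
    (≡.trans (≡.cong (ℕ._+ suc m ℕ.* 2) (twice (suc m)))
      (≡.trans (≡.sym (ℕ.*-distribʳ-+ 2 (triangle (suc m)) (suc m)))
               (≡.cong (ℕ._* 2) (ℕ.+-comm (triangle (suc m)) (suc m)))))

x^-monomial : ∀ e {f g} → f ≋ g → (x^ e · f) ≈ ℤ[[q,x]].monomial e g
x^-monomial zero    f≋g zero    n = f≋g n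
x^-monomial zero    f≋g (suc m) n = ≡.refl
x^-monomial (suc e) f≋g zero    n = ≡.refl
x^-monomial (suc e) f≋g (suc m) n = x^-monomial e f≋g m n

⊘-⋆ : ∀ e f {r} → recip f ≋ r → q^ e ⊘ f ≋ q ^ e ⋆ r
⊘-⋆ e f = ⊗≋⋆ {q^ e} (q^≋^ e)

private
  pochhammer-product : ∀ i j k →
    recip (pochhammer 1 i ⊗ pochhammer 2 j ⊗ pochhammer 3 k) ≋ R 1 i ⋆ R 2 j ⋆ R 3 k
  pochhammer-product i j k = 𝕂.trans
    (recip-⊗ (pochhammer 1 i ⊗ pochhammer 2 j) (pochhammer 3 k)
      (≡.cong₂ ℤ._*_ (pochhammer₀ 1 i) (pochhammer₀ 2 j)) (pochhammer₀ 3 k))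
    (𝕂.*-congʳ {R 3 k} (recip-⊗ (pochhammer 1 i) (pochhammer 2 j) (pochhammer₀ 1 i) (pochhammer₀ 2 j)))

-1^-⋆ : ∀ l f → (-1ℤ ℤ.^ l) ℤ[[q]].∙ f ≋ (𝕂.- 𝕂.1#) ^ l ⋆ f
-1^-⋆ zero    f n = ≡.trans (ℤ.*-identityˡ (f n)) (≡.sym (𝕂.*-identityˡ f n))
-1^-⋆ (suc l) f = begin
  (-1ℤ ℤ.* -1ℤ ℤ.^ l) ℤ[[q]].∙ f
    ≈⟨ (λ n → ℤ.*-assoc -1ℤ (-1ℤ ℤ.^ l) (f n)) ⟩
  -1ℤ ℤ[[q]].∙ ((-1ℤ ℤ.^ l) ℤ[[q]].∙ f)
    ≈⟨ (λ n → ≡.cong (-1ℤ ℤ.*_) (-1^-⋆ l f n)) ⟩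
  -1ℤ ℤ[[q]].∙ ((𝕂.- 𝕂.1#) ^ l ⋆ f)
    ≈⟨ (λ n → ℤ.-1*i≡-i _) ⟩
  𝕂.- ((𝕂.- 𝕂.1#) ^ l ⋆ f)
    ≈⟨ -1*x≈-x ((𝕂.- 𝕂.1#) ^ l ⋆ f) ⟨
  (𝕂.- 𝕂.1#) ⋆ ((𝕂.- 𝕂.1#) ^ l ⋆ f)
    ≈⟨ 𝕂.*-assoc (𝕂.- 𝕂.1#) ((𝕂.- 𝕂.1#) ^ l) f ⟨
  (𝕂.- 𝕂.1#) ^ suc l ⋆ f ∎
  where
  open SetoidReasoning 𝕂.setoid
  open import Algebra.Properties.Ring 𝕂.ring using (-1*x≈-x)

Σ≤-∑𝕂 : ∀ m {F : ℕ → ℤ} {G : ℕ → QSeries} n → (∀ i → F i ≡ G i n) → Σ≤ m F ≡ ∑𝕂.∑ m G n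
Σ≤-∑𝕂 m {G = G} n F≡G = ≡.trans (Σ≤-∑ m F≡G) (≡.sym (ℤ[[q]].∑-coefficient m G n))

tripleSum-θ : tripleSum ≈ θ 0 triple
tripleSum-θ m n = ≡.trans
  (Σ≤-∑𝕂 m n λ i → Σ≤-∑𝕂 m n λ j → Σ≤-∑𝕂 m n λ k → term i j k)
  (≡.sym (θ-triple m n))
  where
  term : ∀ i j k → let M = i ℕ.+ 2 ℕ.* j ℕ.+ 3 ℕ.* k in
    (x^ M · (q^ (M ℕ.* (M ℕ.∸ 1) / 2 ℕ.+ 2 ℕ.* i ℕ.+ j ℕ.^ 2 ℕ.+ 4 ℕ.* j ℕ.+ 5 ℕ.* k)
             ⊘ (pochhammer 1 i ⊗ pochhammer 2 j ⊗ pochhammer 3 k))) m n ≡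
    ℤ[[q,x]].monomial M (q ^ (triangle M ℕ.+ 2 ℕ.* i ℕ.+ j ℕ.^ 2 ℕ.+ 4 ℕ.* j ℕ.+ 5 ℕ.* k)
                         ⋆ (R 1 i ⋆ R 2 j ⋆ R 3 k)) m n
  term i j k rewrite triangle-half (i ℕ.+ 2 ℕ.* j ℕ.+ 3 ℕ.* k) =
    x^-monomial M (⊘-⋆ e _ (pochhammer-product i j k)) m n
    where
    M = i ℕ.+ 2 ℕ.* j ℕ.+ 3 ℕ.* k
    e = triangle M ℕ.+ 2 ℕ.* i ℕ.+ j ℕ.^ 2 ℕ.+ 4 ℕ.* j ℕ.+ 5 ℕ.* k

quadrupleSum-θ : quadrupleSum ≈ θ 0 quadruple
quadrupleSum-θ m n = ≡.trans
  (Σ≤-∑𝕂 m n λ i → Σ≤-∑𝕂 m n λ j → Σ≤-∑𝕂 m n λ k → Σ≤-∑𝕂 m n λ l → term i j k l)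
  (≡.sym (θ-quadruple m n))
  where
  term : ∀ i j k l → let M = i ℕ.+ 2 ℕ.* j ℕ.+ 3 ℕ.* k ℕ.+ 4 ℕ.* l in
    ((-1ℤ ℤ.^ l) · x^ M ·
      (q^ (M ℕ.* (M ℕ.∸ 1) / 2 ℕ.+ 2 ℕ.* i ℕ.+ 5 ℕ.* j ℕ.+ 5 ℕ.* k ℕ.+ 2 ℕ.* l ℕ.^ 2 ℕ.+ 8 ℕ.* l)
        ⊘ (pochhammer 1 i ⊗ pochhammer 2 j ⊗ pochhammer 3 k ⊗ pochhammer 4 l))) m n ≡
    ℤ[[q,x]].monomial M ((𝕂.- 𝕂.1#) ^ l
      ⋆ (q ^ (triangle M ℕ.+ 2 ℕ.* i ℕ.+ 5 ℕ.* j ℕ.+ 5 ℕ.* k ℕ.+ 2 ℕ.* l ℕ.^ 2 ℕ.+ 8 ℕ.* l)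
         ⋆ (R 1 i ⋆ R 2 j ⋆ R 3 k ⋆ R 4 l))) m n
  term i j k l rewrite triangle-half (i ℕ.+ 2 ℕ.* j ℕ.+ 3 ℕ.* k ℕ.+ 4 ℕ.* l) = begin
    -1ℤ ℤ.^ l ℤ.* (x^ M · (q^ e ⊘ f)) m n
      ≡⟨ ≡.cong (-1ℤ ℤ.^ l ℤ.*_) (x^-monomial M (⊘-⋆ e f (𝕂.trans
           (recip-⊗ _ (pochhammer 4 l)
             (≡.cong₂ ℤ._*_ (≡.cong₂ ℤ._*_ (pochhammer₀ 1 i) (pochhammer₀ 2 j)) (pochhammer₀ 3 k))
               (pochhammer₀ 4 l))
           (𝕂.*-congʳ {R 4 l} (pochhammer-product i j k)))) m n) ⟩
    -1ℤ ℤ.^ l ℤ.* ℤ[[q,x]].monomial M g m n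
      ≡⟨ -1^-⋆ l (ℤ[[q,x]].monomial M g m) n ⟩
    ((𝕂.- 𝕂.1#) ^ l ⋆ ℤ[[q,x]].monomial M g m) n
      ≡⟨ ℤ[[q,x]].∙-monomial (const ((𝕂.- 𝕂.1#) ^ l)) M g m n ⟩
    ℤ[[q,x]].monomial M ((𝕂.- 𝕂.1#) ^ l ⋆ g) m n ∎
    where
    open ≡.≡-Reasoning
    M = i ℕ.+ 2 ℕ.* j ℕ.+ 3 ℕ.* k ℕ.+ 4 ℕ.* l
    e = triangle M ℕ.+ 2 ℕ.* i ℕ.+ 5 ℕ.* j ℕ.+ 5 ℕ.* k ℕ.+ 2 ℕ.* l ℕ.^ 2 ℕ.+ 8 ℕ.* l
    f g : QSeries
    f = pochhammer 1 i ⊗ pochhammer 2 j ⊗ pochhammer 3 k ⊗ pochhammer 4 l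
    g = q ^ e ⋆ (R 1 i ⋆ R 2 j ⋆ R 3 k ⋆ R 4 l)

-- Uniqueness of the solution of the recurrences

⋆-cong-deg : ∀ H {F G n} → (∀ m {k} → k ≤ n → F m k ≡ G m k) →
             ∀ m → (H ⊛ F) m n ≡ (H ⊛ G) m n
⋆-cong-deg H F≡G zero    = ℤ[[q]].⋆-cong-≤ _ (λ _ → ≡.refl) (F≡G 0)
⋆-cong-deg H F≡G (suc m) = ≡.cong₂ ℤ._+_
  (ℤ[[q]].⋆-cong-≤ _ (λ _ → ≡.refl) (F≡G (suc m))) (⋆-cong-deg (H ∘ suc) F≡G m)

-- Every series on the right of the recurrences has a larger index t but possibly the same q-degree
-- n. The induction is therefore on k with n < t + k: a step up in t pays for a step down in k, and
-- n < t is the base.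
system-unique : ∀ {E D E′ D′} → System E D → System E′ D′ →
  (∀ t m {n} → n < t → E t m n ≡ E′ t m n) →
  ∀ k t m {n} → n < t ℕ.+ k → E t m n ≡ E′ t m n
system-unique S S′ base zero t m {n} n<t = base t m (≡.subst (n <_) (ℕ.+-identityʳ t) n<t)
system-unique {E} {D} {E′} {D′} S S′ base (suc k) t m {n} n<t+1+k = begin
  E t m n
    ≡⟨ S.E-eq t m n ⟩
  D t m n ℤ.+ (xq 3 (8 ℕ.+ 3 ℕ.* t) ⊛ E (3 ℕ.+ t)) m n
    ≡⟨ ≡.cong (ℤ._+ _) (S.D-eq t m n) ⟩
  (xq 1 (2 ℕ.+ t) ⊛ D (1 ℕ.+ t)) m n ℤ.+ E (1 ℕ.+ t) m n
    ℤ.+ (xq 2 (6 ℕ.+ 2 ℕ.* t) ⊛ E (3 ℕ.+ t)) m n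
    ℤ.+ (xq 3 (8 ℕ.+ 3 ℕ.* t) ⊛ E (3 ℕ.+ t)) m n
    ≡⟨ ≡.cong₂ ℤ._+_ (≡.cong₂ ℤ._+_ (≡.cong₂ ℤ._+_
         (⋆-cong-deg (xq 1 (2 ℕ.+ t)) (λ m k≤n → D≡ (1 ℕ.+ t) m (ℕ.≤-<-trans k≤n n<₁)) m)
         (E≡ (1 ℕ.+ t) m n<₁))
         (⋆-cong-deg (xq 2 (6 ℕ.+ 2 ℕ.* t)) (λ m k≤n → E≡ (3 ℕ.+ t) m (ℕ.≤-<-trans k≤n n<₃)) m))
         (⋆-cong-deg (xq 3 (8 ℕ.+ 3 ℕ.* t)) (λ m k≤n → E≡ (3 ℕ.+ t) m (ℕ.≤-<-trans k≤n n<₃)) m) ⟩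
  (xq 1 (2 ℕ.+ t) ⊛ D′ (1 ℕ.+ t)) m n ℤ.+ E′ (1 ℕ.+ t) m n
    ℤ.+ (xq 2 (6 ℕ.+ 2 ℕ.* t) ⊛ E′ (3 ℕ.+ t)) m n
    ℤ.+ (xq 3 (8 ℕ.+ 3 ℕ.* t) ⊛ E′ (3 ℕ.+ t)) m n
    ≡⟨ ≡.cong (ℤ._+ _) (S′.D-eq t m n) ⟨
  D′ t m n ℤ.+ (xq 3 (8 ℕ.+ 3 ℕ.* t) ⊛ E′ (3 ℕ.+ t)) m n
    ≡⟨ S′.E-eq t m n ⟨
  E′ t m n ∎
  where
  open ≡.≡-Reasoning
  open import Algebra.Properties.AbelianGroup ℤ.+-0-abelianGroup using (∙-cancelʳ)
  module S = System S
  module S′ = System S′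

  E≡ : ∀ t m {n} → n < t ℕ.+ k → E t m n ≡ E′ t m n
  E≡ = system-unique S S′ base k

  -- `E-eq` recovers D from E by cancellation, so the induction runs over E alone.
  D≡ : ∀ t m {n} → n < t ℕ.+ k → D t m n ≡ D′ t m n
  D≡ t m {n} n<t+k = ∙-cancelʳ ((xq 3 (8 ℕ.+ 3 ℕ.* t) ⊛ E (3 ℕ.+ t)) m n) _ _
    (≡.trans (≡.sym (S.E-eq t m n)) (≡.trans (E≡ t m n<t+k) (≡.trans (S′.E-eq t m n)
      (≡.cong (λ z → D′ t m n ℤ.+ z) (≡.sym (⋆-cong-deg (xq 3 (8 ℕ.+ 3 ℕ.* t))
        (λ m k≤n → E≡ (3 ℕ.+ t) m (ℕ.≤-trans (s≤s k≤n) (ℕ.≤-trans n<t+k (ℕ.m≤n+m (t ℕ.+ k) 3)))) m))))))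

  n<₁ : n < (1 ℕ.+ t) ℕ.+ k
  n<₁ = ≡.subst (n <_) (ℕ.+-suc t k) n<t+1+k
  n<₃ : n < (3 ℕ.+ t) ℕ.+ k
  n<₃ = ℕ.m≤n⇒m≤o+n 2 n<₁

-- For m ≥ 1 the coefficient of xᵐ is divisible by q^(tm), and tm ≥ t > n; only x⁰ survives.
θ-low : ∀ {u} → u 0 ≋ 𝕂.1# → ∀ t m {n} → n < t → θ t u m n ≡ ℤ[[q,x]].constant 𝕂.1# m n
θ-low {u} u₀ t zero {n} n<t rewrite ℕ.*-zeroʳ t = ≡.trans (𝕂.*-identityˡ (u 0) n) (u₀ n)
θ-low {u} u₀ t (suc m) {n} n<t = ≡.trans (^-⋆ (t ℕ.* suc m ℕ.+ triangle (suc m)) (u (suc m)) n)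
  (ℤ[[q]].delay-< (u (suc m)) (ℕ.<-≤-trans n<t (ℕ.≤-trans (ℕ.m≤m*n t (suc m))
    (ℕ.m≤m+n _ (triangle (suc m))))))

θ-characterisation : ∀ {E D u} → System E D →
  (∀ t m {n} → n < t → E t m n ≡ ℤ[[q,x]].constant 𝕂.1# m n) →
  Functional u → u 0 ≋ 𝕂.1# → E 0 ≈ θ 0 u
θ-characterisation {u = u} S E-low functional u₀ m n =
  -- k = n + 1 reaches degree n at t = 0, that is, at s = 2.
  system-unique S (proj₂ (θ-system functional))
    (λ t m n<t → ≡.trans (E-low t m n<t) (≡.sym (θ-low {u} u₀ t m n<t))) (suc n) 0 m ℕ.≤-refl

-- Counting lists of naturals by length and sum

-- The coefficient of xᵐ qⁿ in ∑_π w(π) x^(length π) q^(sum π), over all lists π of naturals.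
count : (List ℕ → ℤ) → XQSeries
count w zero    n = w [] ℤ.* 𝟙 n
count w (suc m) n = ∑ℤ.∑ n λ a → count (w ∘ (a ∷_)) m (n ℕ.∸ a)

count-cong : ∀ {v w} → (∀ π → v π ≡ w π) → count v ≈ count w
count-cong v≡w zero    n = ≡.cong (ℤ._* 𝟙 n) (v≡w [])
count-cong v≡w (suc m) n = ∑ℤ.∑-cong n λ a → count-cong (v≡w ∘ (a ∷_)) m (n ℕ.∸ a)

count-+ : ∀ v w → count (λ π → v π ℤ.+ w π) ≈ count v ⊞ count w
count-+ v w zero    n = ℤ.*-distribʳ-+ (𝟙 n) (v []) (w [])
count-+ v w (suc m) n = ≡.trans
  (∑ℤ.∑-cong n λ a → count-+ (v ∘ (a ∷_)) (w ∘ (a ∷_)) m (n ℕ.∸ a)) (∑ℤ.∑-+ n _ _)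

count-zero : ∀ {w} → (∀ π → w π ≡ 0ℤ) → ∀ m n → count w m n ≡ 0ℤ
count-zero w≡0 zero    n = ≡.cong (ℤ._* 𝟙 n) (w≡0 [])
count-zero w≡0 (suc m) n = ∑ℤ.∑-zero n λ a → count-zero (w≡0 ∘ (a ∷_)) m (n ℕ.∸ a)

-- A weight supported on the lists that begin with a, so that prefixing the part a becomes the
-- factor x qᵃ in `count-cons`.
cons : ℕ → (List ℕ → ℤ) → List ℕ → ℤ
cons a w []      = 0ℤ
cons a w (b ∷ π) = if does (b ≟ a) then w π else 0ℤ

count-cons : ∀ a w → count (cons a w) ≈ xq 1 a ⊛ count w
count-cons a w zero    n = ≡.sym (𝕂.zeroˡ (count w 0) n)
count-cons a w (suc m) n = begin
  ∑ℤ.∑ n (λ k → count (cons a w ∘ (k ∷_)) m (n ℕ.∸ k))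
    ≡⟨ ∑ℤ.∑-cong n (λ k → term k (n ℕ.∸ k)) ⟩
  ∑ℤ.∑ n (λ k → (q^ a) k ℤ.* count w m (n ℕ.∸ k))
    ≡⟨ ℤ[[q]].⋆-as-∑ (q^ a) (count w m) n ⟨
  (q^ a ⋆ count w m) n
    ≡⟨ 𝕂.*-congʳ {count w m} (q^≋^ a) n ⟩
  (q ^ a ⋆ count w m) n
    ≡⟨ ℤ[[q,x]].monomial-⋆ 1 (q ^ a) (count w) (suc m) n ⟨
  (xq 1 a ⊛ count w) (suc m) n ∎
  where
  open ≡.≡-Reasoning
  term : ∀ k j → count (cons a w ∘ (k ∷_)) m j ≡ (q^ a) k ℤ.* count w m j
  term k j with does (k ≟ a)
  ... | true  = ≡.sym (ℤ.*-identityˡ (count w m j))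
  ... | false = count-zero (λ _ → ≡.refl) m j

xq-⊛ : ∀ d e s t f → xq d s ⊛ (xq e t ⊛ f) ≈ xq (d ℕ.+ e) (s ℕ.+ t) ⊛ f
xq-⊛ d e s t f = X.trans (X.sym (X.*-assoc (xq d s) (xq e t) f))
  (X.*-congʳ {f} (X.trans (ℤ[[q,x]].monomial-* d e (q ^ s) (q ^ t))
    (ℤ[[q,x]].monomial-cong (d ℕ.+ e) (𝕂.sym (^-homo-* q s t)))))

count-cons² : ∀ a b w → count (cons a (cons b w)) ≈ xq 2 (a ℕ.+ b) ⊛ count w
count-cons² a b w = X.trans (count-cons a (cons b w))
  (X.trans (X.*-congˡ {xq 1 a} (count-cons b w)) (xq-⊛ 1 1 a b (count w)))

count-cons³ : ∀ a b c w → count (cons a (cons b (cons c w))) ≈ xq 3 (a ℕ.+ (b ℕ.+ c)) ⊛ count w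
count-cons³ a b c w = X.trans (count-cons a (cons b (cons c w)))
  (X.trans (X.*-congˡ {xq 1 a} (count-cons² b c w)) (xq-⊛ 1 2 a (b ℕ.+ c) (count w)))

𝕀 : ∀ {A : Set} {P : Pred A 0ℓ} → Decidable P → A → ℤ
𝕀 P? x = if does (P? x) then 1ℤ else 0ℤ

𝕀-cong : ∀ {A : Set} {P Q : Pred A 0ℓ} (P? : Decidable P) (Q? : Decidable Q) {x} →
         P x ⇔ Q x → 𝕀 P? x ≡ 𝕀 Q? x
𝕀-cong P? Q? {x} P⇔Q = ≡.cong (if_then 1ℤ else 0ℤ) (does-⇔ P⇔Q (P? x) (Q? x))

𝕀-∪ : ∀ {A : Set} {P Q : Pred A 0ℓ} (P? : Decidable P) (Q? : Decidable Q) x →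
      ¬ (P x × Q x) → 𝕀 (P? ∪? Q?) x ≡ 𝕀 P? x ℤ.+ 𝕀 Q? x
𝕀-∪ P? Q? x disjoint with P? x | Q? x
... | yes p | yes q = contradiction (p , q) disjoint
... | yes _ | no _  = ≡.refl
... | no _  | yes _ = ≡.refl
... | no _  | no _  = ≡.refl

Cons : ℕ → Pred (List ℕ) 0ℓ → Pred (List ℕ) 0ℓ
Cons a P []      = ⊥
Cons a P (b ∷ π) = b ≡ a × P π

Cons? : ∀ a {P} → Decidable P → Decidable (Cons a P)
Cons? a P? []      = no λ ()
Cons? a P? (b ∷ π) = (b ≟ a) ×-dec P? π

Cons-map : ∀ a {P Q : Pred (List ℕ) 0ℓ} → (∀ {π} → P π → Q π) → ∀ {π} → Cons a P π → Cons a Q π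
Cons-map a f {_ ∷ _} (b≡a , p) = b≡a , f p

𝕀-Cons : ∀ a {P} (P? : Decidable P) {w} → (∀ π → 𝕀 P? π ≡ w π) → ∀ π → 𝕀 (Cons? a P?) π ≡ cons a w π
𝕀-Cons a P? P≡w []      = ≡.refl
𝕀-Cons a P? P≡w (b ∷ π) with does (b ≟ a)
... | true  = P≡w π
... | false = ≡.refl

-- Condition(2)

-- The congruence clause solved: for a ≤ b ≤ c ≤ a + 1 the sum is 3a, 3a + 1, 3a + 2 or 3a + 3 with
-- the first part replaced accordingly, and since the first part is a itself only a, a+1, a+1 has
-- sum ≡ 2 (mod 3).
Flat : ℕ → Pred (List ℕ) 0ℓ
Flat a (b ∷ c ∷ _) = c ≤ 1 ℕ.+ a → b ≡ 1 ℕ.+ a × c ≡ 1 ℕ.+ a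
Flat a _           = ⊤

Steep : ℕ → Pred (List ℕ) 0ℓ
Steep a (_ ∷ _ ∷ d ∷ _) = 3 ℕ.+ a ≤ d
Steep a _               = ⊤

-- Partitions satisfying Condition(2) with all parts at least s.
Valid : ℕ → Pred (List ℕ) 0ℓ
Valid s []      = ⊤
Valid s (a ∷ π) = s ≤ a × Flat a π × Steep a π × Valid a π

-- In a weakly increasing list with parts at least s, a repeated s must occupy the first two places.
Paired : ℕ → Pred (List ℕ) 0ℓ
Paired s = Cons s (Cons s U)

Blocked : ℕ → Pred (List ℕ) 0ℓ
Blocked s = Cons s (Cons (1 ℕ.+ s) (Cons (1 ℕ.+ s) U))

E D : ℕ → Pred (List ℕ) 0ℓ
E s = Valid s ∩ ∁ (Paired s)
D s = E s ∩ ∁ (Blocked s)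

Flat? : ∀ a → Decidable (Flat a)
Flat? a []          = yes tt
Flat? a (_ ∷ [])    = yes tt
Flat? a (b ∷ c ∷ _) = (c ≤? 1 ℕ.+ a) →-dec ((b ≟ 1 ℕ.+ a) ×-dec (c ≟ 1 ℕ.+ a))

Steep? : ∀ a → Decidable (Steep a)
Steep? a []              = yes tt
Steep? a (_ ∷ [])        = yes tt
Steep? a (_ ∷ _ ∷ [])    = yes tt
Steep? a (_ ∷ _ ∷ d ∷ _) = 3 ℕ.+ a ≤? d

Valid? : ∀ s → Decidable (Valid s)
Valid? s []      = yes tt
Valid? s (a ∷ π) = (s ≤? a) ×-dec Flat? a π ×-dec Steep? a π ×-dec Valid? a π

Paired? : ∀ s → Decidable (Paired s)
Paired? s = Cons? s (Cons? s U?)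

Blocked? : ∀ s → Decidable (Blocked s)
Blocked? s = Cons? s (Cons? (1 ℕ.+ s) (Cons? (1 ℕ.+ s) U?))

E? : ∀ s → Decidable (E s)
E? s π = Valid? s π ×-dec ¬? (Paired? s π)

D? : ∀ s → Decidable (D s)
D? s π = E? s π ×-dec ¬? (Blocked? s π)

Valid-weaken : ∀ {s t} → s ≤ t → ∀ π → Valid t π → Valid s π
Valid-weaken s≤t []      _           = tt
Valid-weaken s≤t (a ∷ π) (t≤a , vs) = ℕ.≤-trans s≤t t≤a , vs

Valid-strengthen : ∀ {s} π → Valid s π → ¬ Cons s U π → Valid (1 ℕ.+ s) π
Valid-strengthen []      _          _  = tt
Valid-strengthen (a ∷ π) (s≤a , vs) ¬s =
  ℕ.≤∧≢⇒< s≤a (λ s≡a → ¬s (≡.sym s≡a , tt)) , vs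

Valid-¬Cons : ∀ {s P} π → Valid (1 ℕ.+ s) π → ¬ Cons s P π
Valid-¬Cons (_ ∷ _) (s<s , _) (≡.refl , _) = ℕ.<-irrefl ≡.refl s<s

Valid⇒D : ∀ s π → Valid (1 ℕ.+ s) π → D s π
Valid⇒D s π v = (Valid-weaken (ℕ.n≤1+n s) π v , Valid-¬Cons π v) , Valid-¬Cons π v

E-second : ∀ {s b c} {π : List ℕ} → E s (b ∷ c ∷ π) → s < c
E-second {s} {b} {c} ((s≤b , _ , _ , b≤c , _) , ¬p) with ℕ.m≤n⇒m<n∨m≡n b≤c
... | inj₁ b<c    = ℕ.≤-<-trans s≤b b<c
... | inj₂ ≡.refl = ℕ.≤∧≢⇒< s≤b λ s≡b → ¬p (≡.sym s≡b , ≡.sym s≡b , tt)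

-- After s, s the next part cannot be at most s + 1, since `Flat` would force the second s to equal
-- s + 1; and s + 2 cannot come twice, since `Steep` puts the fourth part at s + 3 or more. `E⇒pair`
-- is the converse.
pair⇒E : ∀ {s} π → Valid s (s ∷ s ∷ π) → E (2 ℕ.+ s) π
pair⇒E     []      _ = tt , λ ()
pair⇒E {s} (c ∷ π) (_ , flat , steep , _ , _ , _ , _ , vs) = (s+2≤c , vs) , ¬paired π steep
  where
  s+2≤c : 2 ℕ.+ s ≤ c
  s+2≤c = ℕ.≰⇒> λ c≤1+s → ℕ.m≢1+m+n s
    (≡.trans (proj₁ (flat c≤1+s)) (≡.cong suc (≡.sym (ℕ.+-identityʳ s))))
  ¬paired : ∀ π → Steep s (s ∷ c ∷ π) → ¬ Paired (2 ℕ.+ s) (c ∷ π)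
  ¬paired (_ ∷ _) steep (_ , ≡.refl , _) = ℕ.<-irrefl ≡.refl steep

E⇒pair : ∀ {s} π → E (2 ℕ.+ s) π → Valid s (s ∷ s ∷ π)
E⇒pair {s} π e@(v , _) =
  ℕ.≤-refl , flat π v , steep π e , ℕ.≤-refl , flat′ π v , steep′ π e , Valid-weaken (ℕ.m≤n+m s 2) π v
  where
  flat : ∀ π → Valid (2 ℕ.+ s) π → Flat s (s ∷ π)
  flat []      _           = tt
  flat (c ∷ _) (s+2≤c , _) c≤1+s = contradiction (ℕ.≤-trans s+2≤c c≤1+s) (ℕ.<-irrefl ≡.refl)
  flat′ : ∀ π → Valid (2 ℕ.+ s) π → Flat s π
  flat′ []          _                           = tt
  flat′ (_ ∷ [])    _                           = tt
  flat′ (c ∷ d ∷ _) (s+2≤c , _ , _ , c≤d , _) d≤1+s =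
    contradiction (ℕ.≤-trans s+2≤c (ℕ.≤-trans c≤d d≤1+s)) (ℕ.<-irrefl ≡.refl)
  steep : ∀ π → E (2 ℕ.+ s) π → Steep s (s ∷ π)
  steep []          _ = tt
  steep (_ ∷ [])    _ = tt
  steep (_ ∷ _ ∷ _) e = E-second e
  steep′ : ∀ π → E (2 ℕ.+ s) π → Steep s π
  steep′ []              _ = tt
  steep′ (_ ∷ [])        _ = tt
  steep′ (_ ∷ _ ∷ [])    _ = tt
  steep′ (_ ∷ _ ∷ _ ∷ _) e@((_ , _ , _ , _ , _ , _ , d≤e , _) , _) = ℕ.≤-trans (E-second e) d≤e

-- Without its first part, the start s, s+1, s+1 is a pair start at s + 1.
blocked⇒E : ∀ {s} π → Valid s (s ∷ 1 ℕ.+ s ∷ 1 ℕ.+ s ∷ π) → E (3 ℕ.+ s) π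
blocked⇒E π (_ , _ , _ , _ , vs) = pair⇒E π (ℕ.≤-refl , vs)

E⇒blocked : ∀ {s} π → E (3 ℕ.+ s) π → E s (s ∷ 1 ℕ.+ s ∷ 1 ℕ.+ s ∷ π)
E⇒blocked {s} π e@(v , _) =
  (ℕ.≤-refl , (λ _ → ≡.refl , ≡.refl) , steep π v , Valid-weaken (ℕ.n≤1+n s) _ (E⇒pair π e)) ,
  λ p → ℕ.1+n≢n (proj₁ (proj₂ p))
  where
  steep : ∀ π → Valid (3 ℕ.+ s) π → Steep s (1 ℕ.+ s ∷ 1 ℕ.+ s ∷ π)
  steep []      _         = tt
  steep (_ ∷ _) (s+3≤d , _) = s+3≤d

E⇔ : ∀ s π → E s π ⇔ (D s ∪ Cons s (Cons (1 ℕ.+ s) (Cons (1 ℕ.+ s) (E (3 ℕ.+ s))))) π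
E⇔ s π = mk⇔ to from
  where
  split : ∀ π → E s π → Blocked s π → Cons s (Cons (1 ℕ.+ s) (Cons (1 ℕ.+ s) (E (3 ℕ.+ s)))) π
  split (_ ∷ _ ∷ _ ∷ π) (v , _) (≡.refl , ≡.refl , ≡.refl , _) = ≡.refl , ≡.refl , ≡.refl , blocked⇒E π v
  join : ∀ π → Cons s (Cons (1 ℕ.+ s) (Cons (1 ℕ.+ s) (E (3 ℕ.+ s)))) π → E s π
  join (_ ∷ _ ∷ _ ∷ π) (≡.refl , ≡.refl , ≡.refl , e) = E⇒blocked π e
  to : E s π → _
  to e with Blocked? s π
  ... | yes b = inj₂ (split π e b)
  ... | no ¬b = inj₁ (e , ¬b)
  from : _ → E s π
  from (inj₁ (e , _)) = e
  from (inj₂ p)       = join π p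

-- Behind s, the start s+1, s+1 would make the list `Blocked`, and the start s+1, s+2, s+2 would
-- violate `Steep`. These are the two exclusions that define D at s + 1.
cons⇒D : ∀ {s} π → D s (s ∷ π) → D (1 ℕ.+ s) π
cons⇒D {s} π (((_ , _ , steep , v) , ¬p) , ¬b) =
  (Valid-strengthen π v (λ p → ¬p (≡.refl , p)) ,
   λ p → ¬b (≡.refl , Cons-map (1 ℕ.+ s) (Cons-map (1 ℕ.+ s) id) p)) ,
  ¬blocked π steep
  where
  ¬blocked : ∀ π → Steep s π → ¬ Blocked (1 ℕ.+ s) π
  ¬blocked (_ ∷ _ ∷ _ ∷ _) steep (_ , _ , ≡.refl , _) = ℕ.<-irrefl ≡.refl steep

D⇒cons : ∀ {s} π → D (1 ℕ.+ s) π → D s (s ∷ π)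
D⇒cons {s} π ((v , ¬p) , ¬b) =
  ((ℕ.≤-refl , flat π v , steep π v ¬p ¬b , Valid-weaken (ℕ.n≤1+n s) π v) ,
   λ p → Valid-¬Cons π v (proj₂ p)) ,
  λ b → ¬p (Cons-map (1 ℕ.+ s) (Cons-map (1 ℕ.+ s) id) (proj₂ b))
  where
  flat : ∀ π → Valid (1 ℕ.+ s) π → Flat s π
  flat []          _ = tt
  flat (_ ∷ [])    _ = tt
  flat (b ∷ c ∷ _) (s<b , _ , _ , b≤c , _) c≤1+s =
    ℕ.≤-antisym (ℕ.≤-trans b≤c c≤1+s) s<b , ℕ.≤-antisym c≤1+s (ℕ.≤-trans s<b b≤c)
  -- If d ≤ s + 2 then b, c, d ∈ {s + 1, s + 2}, so Flat forces (s + 1, s + 2, s + 2).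
  steep : ∀ π → Valid (1 ℕ.+ s) π → ¬ Paired (1 ℕ.+ s) π → ¬ Blocked (1 ℕ.+ s) π → Steep s π
  steep []              _ _ _ = tt
  steep (_ ∷ [])        _ _ _ = tt
  steep (_ ∷ _ ∷ [])    _ _ _ = tt
  steep (b ∷ c ∷ d ∷ _) (s<b , flat , _) ¬p ¬b = ℕ.≰⇒> λ d≤2+s →
    let (c≡1+b , d≡1+b) = flat (ℕ.≤-trans d≤2+s (s≤s s<b))
        b≡1+s = ℕ.≤-antisym (ℕ.s≤s⁻¹ (≡.subst (_≤ 2 ℕ.+ s) d≡1+b d≤2+s)) s<b
        2+s = ≡.cong suc b≡1+s
    in ¬b (b≡1+s , ≡.trans c≡1+b 2+s , ≡.trans d≡1+b 2+s , tt)

-- The cases are: s occurs; s is absent and s + 1 occurs at most once; s is absent and s + 1 is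
-- repeated.
D-cases : ℕ → Pred (List ℕ) 0ℓ
D-cases s = (Cons s (D (1 ℕ.+ s)) ∪ E (1 ℕ.+ s)) ∪ Cons (1 ℕ.+ s) (Cons (1 ℕ.+ s) (E (3 ℕ.+ s)))

D⇔ : ∀ s π → D s π ⇔ D-cases s π
D⇔ s π = mk⇔ (to π) (from π)
  where
  split : ∀ π → Valid (1 ℕ.+ s) π → Paired (1 ℕ.+ s) π → Cons (1 ℕ.+ s) (Cons (1 ℕ.+ s) (E (3 ℕ.+ s))) π
  split (_ ∷ _ ∷ π) v (≡.refl , ≡.refl , _) = ≡.refl , ≡.refl , pair⇒E π v
  to : ∀ π → D s π → D-cases s π
  to π dd@((v , _) , _) with Cons? s U? π
  to (_ ∷ π) dd | yes (≡.refl , _) = inj₁ (inj₁ (≡.refl , cons⇒D π dd))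
  to π ((v , _) , _) | no ¬s with Paired? (1 ℕ.+ s) π
  ... | yes p = inj₂ (split π (Valid-strengthen π v ¬s) p)
  ... | no ¬p = inj₁ (inj₂ (Valid-strengthen π v ¬s , ¬p))
  from : ∀ π → D-cases s π → D s π
  from (_ ∷ π)     (inj₁ (inj₁ (≡.refl , dd)))       = D⇒cons π dd
  from π           (inj₁ (inj₂ (v , _)))             = Valid⇒D s π v
  from (_ ∷ _ ∷ π) (inj₂ (≡.refl , ≡.refl , e))      = Valid⇒D s _ (E⇒pair π e)

Cons-disjoint : ∀ {s t P Q} π → s ≢ t → ¬ (Cons s P π × Cons t Q π)
Cons-disjoint (_ ∷ _) s≢t ((a≡s , _) , (a≡t , _)) = s≢t (≡.trans (≡.sym a≡s) a≡t)

-- The recurrences for the counting series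

ℰ 𝒟 : ℕ → XQSeries
ℰ t = count (𝕀 (E? (2 ℕ.+ t)))
𝒟 t = count (𝕀 (D? (2 ℕ.+ t)))

ℰ-eq : ∀ t → ℰ t ≈ 𝒟 t ⊞ xq 3 (8 ℕ.+ 3 ℕ.* t) ⊛ ℰ (3 ℕ.+ t)
ℰ-eq t = X.trans (count-cong weight) (X.trans (count-+ _ _) (X.+-congˡ {𝒟 t}
  (X.trans (count-cons³ s (1 ℕ.+ s) (1 ℕ.+ s) (𝕀 (E? (3 ℕ.+ s))))
    (X.reflexive (≡.cong (λ e → xq 3 e ⊛ ℰ (3 ℕ.+ t)) exponent)))))
  where
  s = 2 ℕ.+ t
  rest? = Cons? s (Cons? (1 ℕ.+ s) (Cons? (1 ℕ.+ s) (E? (3 ℕ.+ s))))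
  weight : ∀ π → 𝕀 (E? s) π ≡ 𝕀 (D? s) π ℤ.+ cons s (cons (1 ℕ.+ s) (cons (1 ℕ.+ s) (𝕀 (E? (3 ℕ.+ s))))) π
  weight π = ≡.trans (𝕀-cong (E? s) (D? s ∪? rest?) (E⇔ s π)) (≡.trans
    (𝕀-∪ (D? s) rest? π λ ((_ , ¬b) , p) → ¬b (Cons-map s
      (Cons-map (1 ℕ.+ s) (Cons-map (1 ℕ.+ s) (const tt))) p))
    (≡.cong (λ z → 𝕀 (D? s) π ℤ.+ z) (𝕀-Cons s _ (𝕀-Cons (1 ℕ.+ s) _
      (𝕀-Cons (1 ℕ.+ s) (E? (3 ℕ.+ s)) λ _ → ≡.refl)) π)))
  exponent : s ℕ.+ (1 ℕ.+ s ℕ.+ (1 ℕ.+ s)) ≡ 8 ℕ.+ 3 ℕ.* t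
  exponent = solve 1 (λ t → con 2 :+ t :+ (con 3 :+ t :+ (con 3 :+ t)) := con 8 :+ con 3 :* t) ≡.refl t
    where open +-*-Solver

𝒟-eq : ∀ t → 𝒟 t ≈ xq 1 (2 ℕ.+ t) ⊛ 𝒟 (1 ℕ.+ t) ⊞ ℰ (1 ℕ.+ t) ⊞ xq 2 (6 ℕ.+ 2 ℕ.* t) ⊛ ℰ (3 ℕ.+ t)
𝒟-eq t = X.trans (count-cong weight) (X.trans (count-+ _ _) (X.+-cong
  (X.trans (count-+ _ _) (X.+-congʳ {ℰ (1 ℕ.+ t)} (count-cons s (𝕀 (D? (1 ℕ.+ s))))))
  (X.trans (count-cons² (1 ℕ.+ s) (1 ℕ.+ s) (𝕀 (E? (3 ℕ.+ s))))
    (X.reflexive (≡.cong (λ e → xq 2 e ⊛ ℰ (3 ℕ.+ t)) exponent)))))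
  where
  s = 2 ℕ.+ t
  first? = Cons? s (D? (1 ℕ.+ s))
  rest? = Cons? (1 ℕ.+ s) (Cons? (1 ℕ.+ s) (E? (3 ℕ.+ s)))
  weight : ∀ π → 𝕀 (D? s) π ≡ cons s (𝕀 (D? (1 ℕ.+ s))) π ℤ.+ 𝕀 (E? (1 ℕ.+ s)) π
                               ℤ.+ cons (1 ℕ.+ s) (cons (1 ℕ.+ s) (𝕀 (E? (3 ℕ.+ s)))) π
  weight π = ≡.trans (𝕀-cong (D? s) ((first? ∪? E? (1 ℕ.+ s)) ∪? rest?) (D⇔ s π)) (≡.trans
    (𝕀-∪ (first? ∪? E? (1 ℕ.+ s)) rest? π λ
      { (inj₁ f , r)        → Cons-disjoint π (ℕ.1+n≢n ∘ ≡.sym) (f , r)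
      ; (inj₂ (_ , ¬p) , r) → ¬p (Cons-map (1 ℕ.+ s) (Cons-map (1 ℕ.+ s) (const tt)) r) })
    (≡.cong₂ ℤ._+_
      (≡.trans (𝕀-∪ first? (E? (1 ℕ.+ s)) π λ (f , (v , _)) → Valid-¬Cons π v f)
        (≡.cong (ℤ._+ 𝕀 (E? (1 ℕ.+ s)) π) (𝕀-Cons s (D? (1 ℕ.+ s)) (λ _ → ≡.refl) π)))
      (𝕀-Cons (1 ℕ.+ s) _ (𝕀-Cons (1 ℕ.+ s) (E? (3 ℕ.+ s)) λ _ → ≡.refl) π)))
  exponent : 1 ℕ.+ s ℕ.+ (1 ℕ.+ s) ≡ 6 ℕ.+ 2 ℕ.* t
  exponent = solve 1 (λ t → con 3 :+ t :+ (con 3 :+ t) := con 6 :+ con 2 :* t) ≡.refl t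
    where open +-*-Solver

ℰ-system : System ℰ 𝒟
ℰ-system = record { E-eq = ℰ-eq ; D-eq = 𝒟-eq }

-- All parts are at least 2 + t > n, so no nonempty list contributes in degree n.
ℰ-low : ∀ t m {n} → n < t → ℰ t m n ≡ ℤ[[q,x]].constant 𝕂.1# m n
ℰ-low t zero    {n} n<t = ≡.trans (ℤ.*-identityˡ (𝟙 n)) (𝟙≋1# n)
ℰ-low t (suc m) {n} n<t = ≡.trans (∑ℤ.∑-cong-≤ n {g = const 0ℤ} λ {a} a≤n → count-zero (λ π →
    ≡.cong (if_then 1ℤ else 0ℤ) (dec-false (E? (2 ℕ.+ t) (a ∷ π)) λ ((2+t≤a , _) , _) →
      ℕ.<⇒≱ (ℕ.m≤n⇒m≤o+n 2 n<t) (ℕ.≤-trans 2+t≤a a≤n))) m (n ℕ.∸ a))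
  (∑ℤ.∑-zero n λ _ → ≡.refl)

-- The generating function as a weighted count

Condition⇒Flat : ∀ a π → Linked _≤_ (a ∷ π) → Congruent₂ (+ 2) (a ∷ π) → Flat a π
Condition⇒Flat a []          _ _ = tt
Condition⇒Flat a (_ ∷ [])    _ _ = tt
Condition⇒Flat a (b ∷ c ∷ _) (a≤b ∷ b≤c ∷ _) cong c≤1+a =
  go (cases b a≤b (ℕ.≤-trans b≤c c≤1+a)) (cases c (ℕ.≤-trans a≤b b≤c) c≤1+a)
  where
  open +-*-Solver
  cases : ∀ b → a ≤ b → b ≤ 1 ℕ.+ a → b ≡ a ⊎ b ≡ 1 ℕ.+ a
  cases b a≤b b≤1+a with ℕ.m≤n⇒m<n∨m≡n a≤b
  ... | inj₁ a<b = inj₂ (ℕ.≤-antisym b≤1+a a<b)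
  ... | inj₂ a≡b = inj₁ (≡.sym a≡b)

  -- Adding 3 replaces the possibly negative integer n - 2 by the natural number 1 + n; the
  -- forbidden sums 3a and 3a + 1 then leave remainders 1 and 2.
  3∣1+ : ∀ {n} → + 3 ℤ.∣ (+ n ℤ.- + 2) → 3 ℕ.∣ 1 ℕ.+ n
  3∣1+ {n} 3∣ = ∣⇒∣ᵤ (≡.subst (+ 3 ℤ.∣_) (≡.trans (ℤ.+-assoc (+ n) (ℤ.- + 2) (+ 3)) (ℤ.+-comm (+ n) (+ 1)))
    (∣m∣n⇒∣m+n 3∣ (∣-refl {+ 3})))

  3∣ : 3 ℕ.∣ 1 ℕ.+ (a ℕ.+ b ℕ.+ c)
  3∣ = 3∣1+ (cong (≡.subst (c ≤_) (ℕ.+-comm 1 a) c≤1+a))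

  absurd : ∀ {A : Set} r .{{_ : ℕ.NonZero r}} → r < 3 → ∀ {n} → n ≡ 3 ℕ.* a ℕ.+ r → 3 ℕ.∣ n → A
  absurd r r<3 ≡.refl 3∣n = contradiction (ℕ.∣m+n∣m⇒∣n 3∣n (ℕ.m∣m*n a)) (ℕ.>⇒∤ r<3)

  go : b ≡ a ⊎ b ≡ 1 ℕ.+ a → c ≡ a ⊎ c ≡ 1 ℕ.+ a → b ≡ 1 ℕ.+ a × c ≡ 1 ℕ.+ a
  go (inj₂ b≡)     (inj₂ c≡)     = b≡ , c≡
  go (inj₁ ≡.refl) (inj₁ ≡.refl) = absurd 1 (s≤s (s≤s z≤n))
    (solve 1 (λ a → con 1 :+ (a :+ a :+ a) := con 3 :* a :+ con 1) ≡.refl a) 3∣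
  go (inj₁ ≡.refl) (inj₂ ≡.refl) = absurd 2 (s≤s (s≤s (s≤s z≤n)))
    (solve 1 (λ a → con 1 :+ (a :+ a :+ (con 1 :+ a)) := con 3 :* a :+ con 2) ≡.refl a) 3∣
  go (inj₂ ≡.refl) (inj₁ ≡.refl) = contradiction b≤c (ℕ.<-irrefl ≡.refl)

Flat⇒Congruent₂ : ∀ a π → Flat a π → Congruent₂ (+ 2) (a ∷ π)
Flat⇒Congruent₂ a []          _    = tt
Flat⇒Congruent₂ a (_ ∷ [])    _    = tt
Flat⇒Congruent₂ a (b ∷ c ∷ _) flat c≤a+1 with flat (≡.subst (c ≤_) (ℕ.+-comm a 1) c≤a+1)
... | ≡.refl , ≡.refl = divides (+ a)
  (≡.trans (≡.cong (λ n → + n ℤ.- + 2) (solve 1 (λ a → a :+ (con 1 :+ a) :+ (con 1 :+ a) :=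
    con 2 :+ a :* con 3) ≡.refl a))
           (ℤ.pos-* a 3))
  where open +-*-Solver

Gap₃⇒Steep : ∀ a π → Gap₃ (a ∷ π) → Steep a π
Gap₃⇒Steep a []              _   = tt
Gap₃⇒Steep a (_ ∷ [])        _   = tt
Gap₃⇒Steep a (_ ∷ _ ∷ [])    _   = tt
Gap₃⇒Steep a (_ ∷ _ ∷ d ∷ _) gap = ≡.subst (_≤ d) (ℕ.+-comm a 3) gap

Steep⇒Gap₃ : ∀ a π → Steep a π → Gap₃ (a ∷ π)
Steep⇒Gap₃ a []              _     = tt
Steep⇒Gap₃ a (_ ∷ [])        _     = tt
Steep⇒Gap₃ a (_ ∷ _ ∷ [])    _     = tt
Steep⇒Gap₃ a (_ ∷ _ ∷ d ∷ _) steep = ≡.subst (_≤ d) (ℕ.+-comm 3 a) steep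

Condition⇒Valid : ∀ s π → Linked _≤_ (s ∷ π) → Condition (+ 2) π → Valid s π
Condition⇒Valid s []      _              _ = tt
Condition⇒Valid s (a ∷ π) (s≤a ∷ linked) (gap ∷ gaps , congruent ∷ congruents) =
  s≤a , Condition⇒Flat a π linked congruent , Gap₃⇒Steep a π gap , Condition⇒Valid a π linked
    (gaps , congruents)

Valid⇒Linked : ∀ s π → Valid s π → Linked _≤_ (s ∷ π)
Valid⇒Linked s []      _                   = [-]
Valid⇒Linked s (a ∷ π) (s≤a , _ , _ , v) = s≤a ∷ Valid⇒Linked a π v

Valid⇒Condition : ∀ s π → Valid s π → Condition (+ 2) π
Valid⇒Condition s []      _                           = tt ∷ [] , tt ∷ []
Valid⇒Condition s (a ∷ π) (_ , flat , steep , v) =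
  let (gaps , congruents) = Valid⇒Condition a π v in
  Steep⇒Gap₃ a π steep ∷ gaps , Flat⇒Congruent₂ a π flat ∷ congruents

Linked⇒parts≥ : ∀ {s π} → Linked _≤_ (s ∷ π) → All (s ≤_) π
Linked⇒parts≥ linked = All.tail (Linked⇒All ℕ.≤-trans ℕ.≤-refl linked)

-- If the first part is s, all later parts exceed s and the filter keeps only the head; otherwise
-- every part exceeds s.
¬Paired⇒once : ∀ s π → Valid s π → ¬ Paired s π → length (filter (_≟ s) π) ≤ 1
¬Paired⇒once s []      _                  _  = z≤n
¬Paired⇒once s (a ∷ π) (s≤a , _ , _ , v) ¬p with a ≟ s
... | yes ≡.refl = ℕ.≤-reflexive (≡.cong length (≡.trans (filter-accept (_≟ s) ≡.refl)
  (≡.cong (s ∷_) (filter-none (_≟ s) (All.map (λ s<b b≡s → ℕ.<-irrefl (≡.sym b≡s) s<b)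
    (Linked⇒parts≥ (Valid⇒Linked (1 ℕ.+ s) π (Valid-strengthen π v λ p → ¬p (≡.refl , p)))))))))
... | no a≢s = ℕ.≤-trans (ℕ.≤-reflexive (≡.cong length (≡.trans (filter-reject (_≟ s) a≢s)
  (filter-none (_≟ s) (All.map (λ a≤b b≡s → a≢s (ℕ.≤-antisym (≡.subst (a ≤_) b≡s a≤b) s≤a))
    (Linked⇒parts≥ (Valid⇒Linked a π v))))))) z≤n

once⇒¬Paired : ∀ s π → length (filter (_≟ s) π) ≤ 1 → ¬ Paired s π
once⇒¬Paired s (_ ∷ _ ∷ π) once (≡.refl , ≡.refl , _)
  with s≤s () ← ≡.subst (λ xs → length xs ≤ 1) (≡.trans (filter-accept (_≟ s) ≡.refl)
                  (≡.cong (s ∷_) (filter-accept (_≟ s) {xs = π} ≡.refl))) once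

𝒫⇔E : ∀ π → (IsPartition ∩ In𝒫) π ⇔ E 2 π
𝒫⇔E π = mk⇔
  (λ ((sorted , _) , condition , parts≥2 , once) →
    Condition⇒Valid 2 π (linked π sorted parts≥2) condition , once⇒¬Paired 2 π once)
  (λ (v , ¬p) → let parts≥2 = Linked⇒parts≥ (Valid⇒Linked 2 π v) in
    (Linked.tail (Valid⇒Linked 2 π v) , All.map (ℕ.≤-trans (s≤s z≤n)) parts≥2) ,
    Valid⇒Condition 2 π v , parts≥2 , ¬Paired⇒once 2 π v ¬p)
  where
  linked : ∀ π → Linked _≤_ π → All (2 ≤_) π → Linked _≤_ (2 ∷ π)
  linked []      _  _       = [-]
  linked (_ ∷ _) l (2≤a ∷ _) = 2≤a ∷ l

sumOver : ∀ {A : Set} → (A → ℤ) → List A → ℤ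
sumOver w []       = 0ℤ
sumOver w (x ∷ xs) = w x ℤ.+ sumOver w xs

sumOver-cong : ∀ {A : Set} {v w : A → ℤ} → (∀ x → v x ≡ w x) → ∀ xs → sumOver v xs ≡ sumOver w xs
sumOver-cong v≡w []       = ≡.refl
sumOver-cong v≡w (x ∷ xs) = ≡.cong₂ ℤ._+_ (v≡w x) (sumOver-cong v≡w xs)

sumOver-zero : ∀ {A : Set} {w : A → ℤ} → (∀ x → w x ≡ 0ℤ) → ∀ xs → sumOver w xs ≡ 0ℤ
sumOver-zero w≡0 []       = ≡.refl
sumOver-zero w≡0 (x ∷ xs) = ≡.cong₂ ℤ._+_ (w≡0 x) (sumOver-zero w≡0 xs)

sumOver-++ : ∀ {A : Set} (w : A → ℤ) xs ys → sumOver w (xs ++ ys) ≡ sumOver w xs ℤ.+ sumOver w ys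
sumOver-++ w []       ys = ≡.sym (ℤ.+-identityˡ _)
sumOver-++ w (x ∷ xs) ys = ≡.trans (≡.cong (λ z → w x ℤ.+ z) (sumOver-++ w xs ys))
  (≡.sym (ℤ.+-assoc (w x) _ _))

sumOver-map : ∀ {A B : Set} (w : B → ℤ) (f : A → B) xs → sumOver w (map f xs) ≡ sumOver (w ∘ f) xs
sumOver-map w f []       = ≡.refl
sumOver-map w f (x ∷ xs) = ≡.cong (λ z → w (f x) ℤ.+ z) (sumOver-map w f xs)

sumOver-cartesianProductWith : ∀ {A B C : Set} (w : C → ℤ) (f : A → B → C) xs ys →
  sumOver w (cartesianProductWith f xs ys) ≡ sumOver (λ x → sumOver (w ∘ f x) ys) xs
sumOver-cartesianProductWith w f []       ys = ≡.refl
sumOver-cartesianProductWith w f (x ∷ xs) ys = ≡.trans (sumOver-++ w (map (f x) ys) _)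
  (≡.cong₂ ℤ._+_ (sumOver-map w (f x) ys) (sumOver-cartesianProductWith w f xs ys))

sumOver-applyUpTo : ∀ {A : Set} (w : A → ℤ) f n → sumOver w (applyUpTo f (suc n)) ≡ ∑ℤ.∑ n (w ∘ f)
sumOver-applyUpTo w f zero    = ℤ.+-identityʳ _
sumOver-applyUpTo w f (suc n) = ≡.trans (≡.cong (λ z → w (f 0) ℤ.+ z) (sumOver-applyUpTo w (f ∘ suc) n))
  (≡.sym (∑ℤ.∑-head n (w ∘ f)))

length-filter-filter : ∀ {A : Set} {P Q : Pred A 0ℓ} (P? : Decidable P) (Q? : Decidable Q) xs →
  + length (filter Q? (filter P? xs)) ≡ sumOver (𝕀 (P? ∩? Q?)) xs
length-filter-filter P? Q? [] = ≡.refl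
length-filter-filter P? Q? (x ∷ xs) with does (P? x)
... | false = ≡.trans (length-filter-filter P? Q? xs) (≡.sym (ℤ.+-identityˡ _))
... | true with does (Q? x)
...   | false = ≡.trans (length-filter-filter P? Q? xs) (≡.sym (ℤ.+-identityˡ _))
...   | true  = ≡.cong (λ z → 1ℤ ℤ.+ z) (length-filter-filter P? Q? xs)

q^-+ˡ : ∀ {a n} → a ≤ n → ∀ s → (q^ n) (a ℕ.+ s) ≡ (q^ (n ℕ.∸ a)) s
q^-+ˡ z≤n       s = ≡.refl
q^-+ˡ (s≤s a≤n) s = q^-+ˡ a≤n s

q^-> : ∀ {a n} → n < a → ∀ s → (q^ n) (a ℕ.+ s) ≡ 0ℤ
q^-> {suc a} {zero}  _         s = ≡.refl
q^-> {suc a} {suc n} (s≤s n<a) s = q^-> n<a s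

-- The condition on the sum sits in the weight as a coefficient of qⁿ: a first part a > n makes it
-- vanish, and a ≤ n lowers n to n ∸ a, which is the recursion of `count`. The bound b stays fixed
-- while n falls, hence n < b instead of an equation.
sumOver-listsBelow : ∀ w m {b n} → n < b →
  sumOver (λ π → w π ℤ.* (q^ n) (sum π)) (listsBelow m b) ≡ count w m n
sumOver-listsBelow w zero {n = zero}  _ = ℤ.+-identityʳ _
sumOver-listsBelow w zero {n = suc n} _ = ℤ.+-identityʳ _
sumOver-listsBelow w (suc m) {suc b} {n} (s≤s n≤b) = begin
  sumOver f (listsBelow (suc m) (suc b))
    ≡⟨ sumOver-cartesianProductWith f _∷_ (upTo (suc b)) (listsBelow m (suc b)) ⟩
  sumOver (λ a → sumOver (f ∘ (a ∷_)) (listsBelow m (suc b))) (upTo (suc b))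
    ≡⟨ sumOver-applyUpTo _ id b ⟩
  ∑ℤ.∑ b (λ a → sumOver (f ∘ (a ∷_)) (listsBelow m (suc b)))
    ≡⟨ ∑ℤ.∑-extend n≤b (λ {a} n<a → sumOver-zero (λ π →
         ≡.trans (≡.cong (w (a ∷ π) ℤ.*_) (q^-> n<a (sum π))) (ℤ.*-zeroʳ (w (a ∷ π))))
           (listsBelow m (suc b))) ⟩
  ∑ℤ.∑ n (λ a → sumOver (f ∘ (a ∷_)) (listsBelow m (suc b)))
    ≡⟨ ∑ℤ.∑-cong-≤ n (λ {a} a≤n → ≡.trans
         (sumOver-cong (λ π → ≡.cong (w (a ∷ π) ℤ.*_) (q^-+ˡ a≤n (sum π))) (listsBelow m (suc b)))
         (sumOver-listsBelow (w ∘ (a ∷_)) m (s≤s (ℕ.≤-trans (ℕ.m∸n≤m n a) n≤b)))) ⟩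
  count w (suc m) n ∎
  where
  open ≡.≡-Reasoning
  f : List ℕ → ℤ
  f π = w π ℤ.* (q^ n) (sum π)

genFun-count : ∀ {P : Pred (List ℕ) 0ℓ} (P? : Decidable P) → genFun P? ≈ count (𝕀 (isPartition? ∩? P?))
genFun-count P? m n = ≡.trans (length-filter-filter _ P? (listsBelow m (suc n)))
  (≡.trans (sumOver-cong weight (listsBelow m (suc n))) (sumOver-listsBelow _ m ℕ.≤-refl))
  where
  weight : ∀ π → 𝕀 ((λ π → isPartition? π ×-dec (sum π ≟ n)) ∩? P?) π ≡ 𝕀 (isPartition? ∩? P?) π ℤ.* (q^ n)
    (sum π)
  weight π with does (isPartition? π) | does (sum π ≟ n) | does (P? π)
  ... | false | _     | _     = ≡.refl
  ... | true  | false | false = ≡.refl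
  ... | true  | false | true  = ≡.refl
  ... | true  | true  | false = ≡.refl
  ... | true  | true  | true  = ≡.refl

genFun-ℰ : genFun in𝒫? ≈ ℰ 0
genFun-ℰ m n = ≡.trans (genFun-count in𝒫? m n)
  (count-cong (λ π → 𝕀-cong (isPartition? ∩? in𝒫?) (E? 2) (𝒫⇔E π)) m n)

genFun-θ : ∀ {u} → Functional u → u 0 ≋ 𝕂.1# → genFun in𝒫? ≈ θ 0 u
genFun-θ {u} functional u₀ m n = ≡.trans (genFun-ℰ m n)
  (θ-characterisation {u = u} ℰ-system ℰ-low functional u₀ m n)

mainTheorem7 : (genFun in𝒫? ≈ tripleSum) × (genFun in𝒫? ≈ quadrupleSum)
mainTheorem7 =
  (λ m n → ≡.trans (genFun-θ {triple} triple-functional triple-zero m n) (≡.sym (tripleSum-θ m n))) ,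
  (λ m n → ≡.trans (genFun-θ {quadruple} quadruple-functional quadruple-zero m n)
    (≡.sym (quadrupleSum-θ m n)))
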